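{- Let $G$ be a finite plane graph and $\mathcal{H}$ a collection of connected vertex sets of $G$ that spans $G$, each of which contains a vertex incident to the outer face of $G$. Let $\mathcal{B}$ be a collection of pairwise disjoint connected vertex sets of $G$ such that $I_{\mathcal{H}}(B)$ has weak diameter at most $30$ in $\mathbf{RIG}(G,\mathcal{H})$ for every $B\in\mathcal{B}$, and such that for every $B\in\mathcal{B}$, either $B$ contains a vertex incident to the outer face of $G$ and $I_{\mathcal{H}}(B)$ has weak diameter at most $10$ in $\mathbf{RIG}(G,\mathcal{H})$, or $B$ touches some $B'\in\mathcal{B}$ that contains a vertex incident to the outer face of $G$. Suppose further that for every vertex set $K$ of a connected component of $G-\bigcup_{B\in\mathcal{B}}B$, at least one of the following holds: (1) $I_{\mathcal{H}}(K)$ has weak diameter at most $10$ in $\mathbf{RIG}(G,\mathcal{H})$ and $K$ contains a vertex incident to the outer face of $G$; or $I_{\mathcal{H}}(K)$ has weak diameter at most $30$ in $\mathbf{RIG}(G,\mathcal{H})$ and $K$ touches some $B\in\mathcal{B}$ that contains a vertex incident to the outer face of $G$; (2) $K$ contains a vertex incident to the outer face of $G$ and touches no $B\in\mathcal{B}$; (3) $K$ contains a vertex incident to the outer face of $G$ and touches exactly one $B\in\mathcal{B}$; (4) $K$ contains a vertex incident to the outer face of $G$ and there exist distinct $B_1,B_2\in\mathcal{B}$ such that $K$ touches $B_1$ and $B_2$ and no other member of $\mathcal{B}$, both $B_1$ and $B_2$ contain a vertex incident to the outer face of $G$, and $B_1$ and $B_2$ both contain a vertex incident to a common face of $G$ other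 than the outer face. Then there is a collection $\mathcal{M}$ of pairwise disjoint connected vertex sets of $G$ with $\bigcup_{M\in\mathcal{M}}M=V(G)$ such that $I_{\mathcal{H}}(M)$ has weak diameter at most $30$ in $\mathbf{RIG}(G,\mathcal{H})$ for every $M\in\mathcal{M}$, and for every $M\in\mathcal{M}$, either $M$ contains a vertex incident to the outer face of $G$ and $I_{\mathcal{H}}(M)$ has weak diameter at most $10$ in $\mathbf{RIG}(G,\mathcal{H})$, or $M$ touches some $M'\in\mathcal{M}$ that contains a vertex incident to the outer face of $G$.
   Context: A plane graph is a planar graph with a fixed embedding; its outer face is the unbounded face. A vertex set $A$ is connected if $G[A]$ is connected. $\mathcal{H}$ spans $G$ if every edge of $G$ has both ends in some member of $\mathcal{H}$. The weak diameter of a vertex set $A$ in a graph $X$ is $\max_{a,b\in A}d_X(a,b)$. $I_{\mathcal{C}}(F)$ is the set of members of the collection $\mathcal{C}$ that intersect $F$. $\mathbf{RIG}(G,\mathcal{H})$ is the graph on $\mathcal{H}$ with distinct members adjacent iff they intersect. Two disjoint vertex sets touch if some edge of $G$ has one end in each. -}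

module Defs where

open import Data.Nat using (ℕ; zero; suc; _+_; _*_; _<_; _≤ᵇ_)
open import Data.Bool using (Bool; true; false; _∧_; if_then_else_)
open import Data.Fin using (Fin; toℕ; _≟_)
open import Data.Fin.Subset using (Subset; _∈_)
open import Data.List using (List; upTo; allFin; filter; length; foldr)
open import Data.List.Membership.Propositional renaming (_∈_ to _∈ₗ_)
open import Data.Maybe using (Maybe; just; nothing)
open import Data.Product using (Σ; ∃; ∃-syntax; _×_; _,_)
open import Data.Sum using (_⊎_)
open import Relation.Nullary using (¬_)
open import Relation.Nullary.Decidable using (⌊_⌋)
open import Relation.Binary.PropositionalEquality using (_≡_; _≢_)
open import Relation.Binary.Construct.Closure.ReflexiveTransitive using (Star)

iter : ∀ {A : Set} → (A → A) → ℕ → A → A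
iter f zero    x = x
iter f (suc i) x = f (iter f i x)

countFin : ∀ {m} → (Fin m → Bool) → ℕ
countFin {m} p = length (filter (λ x → p x Data.Bool.≟ true) (allFin m))

-- x is the least element (w.r.t. toℕ) of its orbit under a map on Fin d
-- (for a permutation of Fin d the orbit of x is {f^i x | i < d})
isOrbitRep : ∀ {d} → (Fin d → Fin d) → Fin d → Bool
isOrbitRep {d} f x = foldr (λ i b → (toℕ x ≤ᵇ toℕ (iter f i x)) ∧ b) true (upTo d)

-- Finite simple plane graphs, described combinatorially (up to
-- orientation-preserving homeomorphism of the plane):
--  * vertices Fin n, darts (half-edges) Fin d, `tail` the vertex of a dart,
--    `α` the fixed-point-free involution pairing the two darts of an edge;
--  * `σ` a rotation system (cyclic order of darts around each vertex);
--    faces of each connected component are the orbits of φ = σ ∘ α;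
--  * each component with edges satisfies Euler's formula V - E + F = 2
--    (i.e. its rotation system has genus 0);
--  * `comp` labels connected components;
--  * each component with edges has a chosen "outer" face (a dart of it);
--    a component without edges is a single vertex, its unique face is outer;
--  * `parent k` says in which inner face of which other component the
--    component k is drawn (`nothing`: k lies in the unbounded face);
--    nesting is acyclic (rank function).

record PlaneGraph : Set where
  field
    n d c   : ℕ
    tail    : Fin d → Fin n
    α σ σ⁻  : Fin d → Fin d
    α-invol : ∀ x → α (α x) ≡ x
    σ⁻σ     : ∀ x → σ⁻ (σ x) ≡ x
    σσ⁻     : ∀ x → σ (σ⁻ x) ≡ x
    σ-tail  : ∀ x → tail (σ x) ≡ tail x
    σ-trans : ∀ x y → tail x ≡ tail y → ∃[ i ] iter σ i x ≡ y
    noLoop  : ∀ x → tail (α x) ≢ tail x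
    noMulti : ∀ x y → tail x ≡ tail y → tail (α x) ≡ tail (α y) → x ≡ y
    comp       : Fin n → Fin c
    comp-onto  : ∀ k → ∃[ v ] comp v ≡ k
    comp-edge  : ∀ x → comp (tail (α x)) ≡ comp (tail x)
    comp-conn  : ∀ u v → comp u ≡ comp v →
                 Star (λ a b → ∃[ x ] (tail x ≡ a × tail (α x) ≡ b)) u v
    outerDart         : Fin c → Maybe (Fin d)
    outerDart-just    : ∀ k o → outerDart k ≡ just o → comp (tail o) ≡ k
    outerDart-nothing : ∀ k x → outerDart k ≡ nothing → comp (tail x) ≢ k
    euler : ∀ k o → outerDart k ≡ just o →
            2 * ( countFin (λ v → ⌊ comp v ≟ k ⌋)
                + countFin (λ x → ⌊ comp (tail x) ≟ k ⌋ ∧ isOrbitRep (λ y → σ (α y)) x))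
            ≡ countFin (λ x → ⌊ comp (tail x) ≟ k ⌋) + 4
    parent    : Fin c → Maybe (Fin c × Fin d)
    parent-ok : ∀ k j y → parent k ≡ just (j , y) →
                comp (tail y) ≡ j ×
                ∃[ o ] (outerDart j ≡ just o × ¬ (∃[ i ] iter (λ z → σ (α z)) i o ≡ y))
    rank      : Fin c → ℕ
    rank-lt   : ∀ k j y → parent k ≡ just (j , y) → rank j < rank k

module _ (G : PlaneGraph) where
  open PlaneGraph G

  VSet : Set
  VSet = Subset n

  φ : Fin d → Fin d
  φ y = σ (α y)

  SameFace : Fin d → Fin d → Set
  SameFace x y = ∃[ i ] iter φ i x ≡ y

  Adj : Fin n → Fin n → Set
  Adj u v = ∃[ x ] (tail x ≡ u × tail (α x) ≡ v)

  OnLocalOuter : Fin c → Fin n → Set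
  OnLocalOuter k v = comp v ≡ k ×
    ( outerDart k ≡ nothing
    ⊎ ∃[ o ] (outerDart k ≡ just o × ∃[ y ] (SameFace o y × tail y ≡ v)))

  OnOuterFace : Fin n → Set
  OnOuterFace v = parent (comp v) ≡ nothing × OnLocalOuter (comp v) v

  InnerFaceDart : Fin d → Set
  InnerFaceDart x = ∃[ o ] (outerDart (comp (tail x)) ≡ just o × ¬ SameFace o x)

  OnInnerFace : Fin d → Fin n → Set
  OnInnerFace x v =
      (∃[ y ] (SameFace x y × tail y ≡ v))
    ⊎ (∃[ j ] ∃[ y ] (parent (comp v) ≡ just (j , y) × SameFace x y × OnLocalOuter (comp v) v))

  Meets : VSet → VSet → Set
  Meets A B = ∃[ v ] (v ∈ A × v ∈ B)

  Disjoint : VSet → VSet → Set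
  Disjoint A B = ¬ Meets A B

  Connected : VSet → Set
  Connected A = (∃[ v ] v ∈ A) ×
    (∀ u v → u ∈ A → v ∈ A → Star (λ a b → a ∈ A × b ∈ A × Adj a b) u v)

  Touches : VSet → VSet → Set
  Touches A B = Disjoint A B × ∃[ u ] ∃[ v ] (u ∈ A × v ∈ B × Adj u v)

  HasOuter : VSet → Set
  HasOuter A = ∃[ v ] (v ∈ A × OnOuterFace v)

  Spans : List VSet → Set
  Spans ℋ = ∀ u v → Adj u v → ∃[ H ] (H ∈ₗ ℋ × u ∈ H × v ∈ H)

  PairwiseDisjoint : List VSet → Set
  PairwiseDisjoint 𝒞 = ∀ A B → A ∈ₗ 𝒞 → B ∈ₗ 𝒞 → A ≡ B ⊎ Disjoint A B

  data RIGPath (ℋ : List VSet) : ℕ → VSet → VSet → Set where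
    here : ∀ {k H} → RIGPath ℋ k H H
    step : ∀ {k H H₁ H'} → H₁ ∈ₗ ℋ → Meets H H₁ → RIGPath ℋ k H₁ H' →
           RIGPath ℋ (suc k) H H'

  WDiam≤ : List VSet → ℕ → VSet → Set
  WDiam≤ ℋ k F = ∀ H H' → H ∈ₗ ℋ → H' ∈ₗ ℋ → Meets H F → Meets H' F →
                 RIGPath ℋ k H H'

  GoodMember : List VSet → List VSet → VSet → Set
  GoodMember ℋ 𝒞 A = (HasOuter A × WDiam≤ ℋ 10 A)
                   ⊎ ∃[ A' ] (A' ∈ₗ 𝒞 × Touches A A' × HasOuter A')

  InUnion : List VSet → Fin n → Set
  InUnion 𝒞 v = ∃[ B ] (B ∈ₗ 𝒞 × v ∈ B)

  IsComponentOutside : List VSet → VSet → Set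
  IsComponentOutside 𝒞 K = (∀ v → v ∈ K → ¬ InUnion 𝒞 v) × Connected K ×
    (∀ u v → u ∈ K → ¬ InUnion 𝒞 v → Adj u v → v ∈ K)

  ShareInnerFace : VSet → VSet → Set
  ShareInnerFace A B = ∃[ x ] (InnerFaceDart x ×
    ∃[ a ] (a ∈ A × OnInnerFace x a) × ∃[ b ] (b ∈ B × OnInnerFace x b))

  ComponentCase : List VSet → List VSet → VSet → Set
  ComponentCase ℋ ℬ K =
      ( (WDiam≤ ℋ 10 K × HasOuter K)
      ⊎ (WDiam≤ ℋ 30 K × ∃[ B ] (B ∈ₗ ℬ × Touches K B × HasOuter B)))
    ⊎ (HasOuter K × (∀ B → B ∈ₗ ℬ → ¬ Touches K B))
    ⊎ (HasOuter K × ∃[ B ] (B ∈ₗ ℬ × Touches K B ×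
         (∀ B' → B' ∈ₗ ℬ → Touches K B' → B' ≡ B)))
    ⊎ (HasOuter K × ∃[ B₁ ] ∃[ B₂ ] (B₁ ∈ₗ ℬ × B₂ ∈ₗ ℬ × B₁ ≢ B₂ ×
         Touches K B₁ × Touches K B₂ ×
         (∀ B' → B' ∈ₗ ℬ → Touches K B' → B' ≡ B₁ ⊎ B' ≡ B₂) ×
         HasOuter B₁ × HasOuter B₂ × ShareInnerFace B₁ B₂))

{-# OPTIONS --safe #-}

-- In each component fix a root member of ℋ (or the single vertex of a component without one),
-- and let the level of a vertex be its RIG-distance from the root. The pieces are the components
-- of the subgraphs induced by the levels {0,1,2}, {3,4}, {5,6}, ... A member of ℋ through a
-- vertex of level l+1 that meets level l lies in the levels l and l+1. Hence a piece with a
-- vertex of the upper of its two levels contains a whole member of ℋ, so an outer vertex, and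
-- every piece of levels {2j+3, 2j+4} touches such a piece of the preceding levels.
--
-- For the diameter, attach to every vertex w of a piece of levels {2j+3, 2j+4} a nearby spine:
-- a set of vertices of levels 2j+1 and 2j+2 that reaches the outer face and is adjacent to the
-- piece and to the ball of radius 2j. Three pairwise disjoint spines cannot
-- exist. Indeed, list the ends of the spines on the outer face in cyclic order starting from an
-- outer vertex of the ball: the ball together with the middle spine, and the piece together
-- with the other two, are connected and disjoint but alternate on the outer face. So along a walk
-- inside the piece all spines meet one of the two spines at its ends, which bounds the distance.
--
-- Alternating walks are excluded by homology modulo 2: Euler's formula makes every even chain
-- the coboundary of a function on the faces.

module Submission where

open import Defs
open import Algebra.Bundles using (CommutativeRing)
open import Data.Bool using (Bool; true; false; _∧_; _xor_; T)
import Data.Bool as Bool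
open import Data.Bool.Properties using (xor-∧-commutativeRing; xor-same; xor-comm; xor-assoc; xor-identityʳ; ∧-zeroʳ; ∧-identityʳ; ∧-distribˡ-xor)
open import Data.Empty using (⊥; ⊥-elim)
open import Data.Fin using (Fin; toℕ; zero; suc; _≟_; combine; funToFin; finToFun)
open import Data.Fin.Permutation using (Permutation′; permutation)
open import Data.Fin.Properties using (any?; pigeonhole; toℕ-injective; toℕ<n; injective⇒≤; finToFun-funToFin; funToFin-finToFin)
open import Data.Fin.Subset using (Subset; _∈_; ⁅_⁆)
open import Data.Fin.Subset.Properties using (_∈?_; ⊆-antisym; x∈⁅x⁆; x∈⁅y⁆⇒x≡y)
open import Data.List using (List; []; _∷_; _++_; length; lookup; foldr; map; filter; allFin; applyUpTo; cartesianProduct)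
import Data.List.Membership.DecPropositional as DecMembership
open import Data.List.Membership.Propositional using (find; lose) renaming (_∈_ to _∈ₗ_)
open import Data.List.Membership.Propositional.Properties using (∈-lookup; ∈-map⁺; ∈-map⁻; ∈-++⁺ˡ; ∈-++⁺ʳ; ∈-++⁻; ∈-filter⁺; ∈-filter⁻; ∈-allFin; ∈-cartesianProduct⁺; ∈-cartesianProduct⁻)
open import Data.List.Properties using (length-map; length-++)
open import Data.List.Relation.Unary.All as All using ([]; _∷_)
open import Data.List.Relation.Unary.AllPairs using ([]; _∷_)
open import Data.List.Relation.Unary.Any as Any using (here; there)
open import Data.List.Relation.Unary.Any.Properties using (lookup-index)
open import Data.List.Relation.Unary.Unique.Propositional using (Unique)
import Data.List.Relation.Unary.Unique.Propositional.Properties as Unique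
open import Data.Maybe using (just; nothing)
open import Data.Nat using (ℕ; zero; suc; pred; _+_; _*_; _∸_; _^_; ⌊_/2⌋; _≤_; _<_; z≤n; s≤s; s<s; _≤ᵇ_; _<ᵇ_; _≤?_; _<?_)
import Data.Nat as ℕ
open import Data.Nat.DivMod using (_%_; _/_; m≡m%n+[m/n]*n; m%n<n)
open import Data.Nat.Properties hiding (_≟_)
open import Data.Product using (∃; ∃-syntax; _×_; _,_; proj₁; proj₂)
import Data.Product.Properties as Product
open import Data.Sum using (_⊎_; inj₁; inj₂)
import Data.Sum.Properties as Sum
open import Data.Unit using (⊤; tt)
import Data.Unit.Properties as Unit
open import Data.Vec using (tabulate)
open import Data.Vec.Properties using (lookup∘tabulate; []=⇒lookup; lookup⇒[]=)
open import Function using (_∘_; mk⇔)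
open import Relation.Binary.Construct.Closure.ReflexiveTransitive using (Star; ε; _◅_; _◅◅_)
import Relation.Binary.Construct.Closure.ReflexiveTransitive as Star
open import Relation.Binary.Definitions using (DecidableEquality; tri<; tri≈; tri>)
open import Relation.Binary.PropositionalEquality
open import Relation.Nullary using (¬_; Dec; yes; no; does)
open import Relation.Nullary.Decidable using (⌊_⌋; does-⇔; dec-true; dec-false; toWitness; isYes≗does; map′; _×-dec_; _⊎-dec_)
open import Relation.Unary using (Decidable; _∪_; _∩_)
open import Algebra.Properties.CommutativeMonoid.Sum (CommutativeRing.+-commutativeMonoid xor-∧-commutativeRing) using (sum; sum-cong-≗; ∑-distrib-+; ∑-comm; sum-permute)
open import Algebra.Properties.Semiring.Sum (CommutativeRing.semiring xor-∧-commutativeRing) using (*-distribˡ-sum)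

least : ∀ {P : ℕ → Set} → Decidable P → ∀ {k} → P k → ∃[ m ] (P m × m ≤ k × (∀ j → j < m → ¬ P j))
least P? {k} pk with P? 0
... | yes p0 = 0 , p0 , z≤n , λ _ ()
least P? {zero}  pk | no ¬p0 = ⊥-elim (¬p0 pk)
least P? {suc k} pk | no ¬p0 with least (λ i → P? (suc i)) pk
... | m , pm , m≤k , min = suc m , pm , s≤s m≤k , λ { zero _ → ¬p0 ; (suc j) (s<s j<m) → min j j<m }

-- Orbits of permutations

module _ {A : Set} (f : A → A) where

  iter-+ : ∀ i j x → iter f (i + j) x ≡ iter f i (iter f j x)
  iter-+ zero    j x = refl
  iter-+ (suc i) j x = cong f (iter-+ i j x)

  iter-suc : ∀ i x → iter f i (f x) ≡ iter f (suc i) x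
  iter-suc zero    x = refl
  iter-suc (suc i) x = cong f (iter-suc i x)

  iter-* : ∀ i j x → iter f j x ≡ x → iter f (i * j) x ≡ x
  iter-* zero    j x e = refl
  iter-* (suc i) j x e = trans (iter-+ j (i * j) x) (trans (cong (iter f j) (iter-* i j x e)) e)

  iter-preserves : ∀ {B : Set} (g : A → B) → (∀ x → g (f x) ≡ g x) → ∀ i x → g (iter f i x) ≡ g x
  iter-preserves g e zero    x = refl
  iter-preserves g e (suc i) x = trans (e _) (iter-preserves g e i x)

  iter-injective : (∀ {x y} → f x ≡ f y → x ≡ y) → ∀ i {x y} → iter f i x ≡ iter f i y → x ≡ y
  iter-injective inj zero    e = e
  iter-injective inj (suc i) e = iter-injective inj i (inj e)

  iter-cancel : (∀ {x y} → f x ≡ f y → x ≡ y) → ∀ i j x → iter f (i + j) x ≡ iter f i x → iter f j x ≡ x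
  iter-cancel inj i j x e = iter-injective inj i (trans (sym (iter-+ i j x)) e)

module _ {d : ℕ} (f : Fin d → Fin d) (inj : ∀ {x y} → f x ≡ f y → x ≡ y) where

  -- Pigeonhole on the `d + 1` iterates from exponent 0 to `d`; injectivity cancels the smaller
  -- exponent. The period is written `suc l` so that it can serve as a modulus.
  iter-period : ∀ x → ∃[ l ] (suc l ≤ d × iter f (suc l) x ≡ x)
  iter-period x with pigeonhole (n<1+n d) (λ i → iter f (toℕ i) x)
  ... | i , j , i<j , e with m≤n⇒∃[o]m+o≡n i<j
  ... | l , 1+i+l≡j = l , ≤-trans (m≤n+m (suc l) (toℕ i)) (subst (_≤ d) (sym i+l≡j) (≤-pred (toℕ<n j)))
                  , iter-cancel f inj (toℕ i) (suc l) x (trans (cong (λ k → iter f k x) i+l≡j) (sym e))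
    where i+l≡j = trans (+-suc (toℕ i) l) 1+i+l≡j

  iter-return : ∀ i x → ∃[ j ] iter f j (iter f i x) ≡ x
  iter-return i x with iter-period x
  ... | l , _ , e = i * l , trans (sym (iter-+ f (i * l) i x))
                        (trans (cong (λ k → iter f k x) (trans (+-comm (i * l) i) (sym (*-suc i l))))
                               (iter-* f i (suc l) x e))

  iter-bounded : ∀ i x → ∃[ j ] (j < d × iter f j x ≡ iter f i x)
  iter-bounded i x with iter-period x
  ... | l , l<d , e = i % suc l , <-≤-trans (m%n<n i (suc l)) l<d ,
        sym (trans (cong (λ k → iter f k x) (m≡m%n+[m/n]*n i (suc l)))
            (trans (iter-+ f (i % suc l) (i / suc l * suc l) x)
                   (cong (iter f (i % suc l)) (iter-* f (i / suc l) (suc l) x e))))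

  -- If the iterates `i < j` agreed, applying `f` another `l ∸ j` times would show iterate `l`
  -- already at the earlier index `l ∸ j + i`.
  first-visit-injective : ∀ x l → (∀ j → j < l → iter f j x ≢ iter f l x) →
                          ∀ i j → i < j → j ≤ l → iter f i x ≢ iter f j x
  first-visit-injective x l first i j i<j j≤l e =
    first (l ∸ j + i) (subst (l ∸ j + i <_) (m∸n+n≡m j≤l) (+-monoʳ-< (l ∸ j) i<j))
      (trans (iter-+ f (l ∸ j) i x) (trans (cong (iter f (l ∸ j)) e)
        (trans (sym (iter-+ f (l ∸ j) j x)) (cong (λ k → iter f k x) (m∸n+n≡m j≤l)))))

  OrbitMin : Fin d → ℕ → Set
  OrbitMin x i = ∀ j → toℕ (iter f i x) ≤ toℕ (iter f j x)

  orbitMin : ∀ x → ∃ (OrbitMin x)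
  orbitMin x with argmin d
    where
    argmin : ∀ m → ∃[ i ] (∀ j → j < m → toℕ (iter f i x) ≤ toℕ (iter f j x))
    argmin zero = 0 , λ _ ()
    argmin (suc m) with argmin m
    ... | i , min with toℕ (iter f i x) ≤? toℕ (iter f m x)
    ... | yes p = i , λ j j<1+m → keep j (m<1+n⇒m<n∨m≡n j<1+m)
      where
      keep : ∀ j → j < m ⊎ j ≡ m → toℕ (iter f i x) ≤ toℕ (iter f j x)
      keep j (inj₁ j<m)  = min j j<m
      keep j (inj₂ refl) = p
    ... | no ¬p = m , λ j j<1+m → replace j (m<1+n⇒m<n∨m≡n j<1+m)
      where
      replace : ∀ j → j < m ⊎ j ≡ m → toℕ (iter f m x) ≤ toℕ (iter f j x)
      replace j (inj₁ j<m)  = ≤-trans (<⇒≤ (≰⇒> ¬p)) (min j j<m)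
      replace j (inj₂ refl) = ≤-refl
  ... | i , min = i , λ j → let (j′ , j′<d , e) = iter-bounded j x
                            in ≤-trans (min j′ j′<d) (≤-reflexive (cong toℕ e))

  -- A canonical name for the orbit: a function of representatives is a function on faces. It is the
  -- same least dart that `isOrbitRep` singles out when Euler's formula counts faces.
  orbitRep : Fin d → Fin d
  orbitRep x = iter f (proj₁ (orbitMin x)) x

  orbitRep-∘ : ∀ x → orbitRep (f x) ≡ orbitRep x
  orbitRep-∘ x = toℕ-injective (≤-antisym
      (let (j , e) = iter-return 1 x; i = proj₁ (orbitMin x) in
        ≤-trans (proj₂ (orbitMin (f x)) (i + j))
                (≤-reflexive (cong toℕ (trans (iter-+ f i j (f x)) (cong (iter f i) e)))))
      (≤-trans (proj₂ (orbitMin x) (suc (proj₁ (orbitMin (f x)))))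
               (≤-reflexive (cong toℕ (sym (iter-suc f (proj₁ (orbitMin (f x))) x))))))

  -- The Boolean test inspects only the first `d` iterates, which suffices because `iter-bounded`
  -- brings the minimising exponent below `d`.
  orbitRep-isOrbitRep : ∀ x → isOrbitRep f x ≡ true → orbitRep x ≡ x
  orbitRep-isOrbitRep x e = toℕ-injective (≤-antisym (proj₂ (orbitMin x) 0)
      (let (j , j<d , e′) = iter-bounded (proj₁ (orbitMin x)) x
       in ≤-trans (unfold d (λ i → i) e j j<d) (≤-reflexive (cong toℕ e′))))
    where
    unfold : ∀ m (g : ℕ → ℕ) →
             foldr (λ i b → (toℕ x ≤ᵇ toℕ (iter f i x)) ∧ b) true (applyUpTo g m) ≡ true →
             ∀ j → j < m → toℕ x ≤ toℕ (iter f (g j) x)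
    unfold (suc m) g e j j<m with toℕ x ≤ᵇ toℕ (iter f (g 0) x) in eq
    unfold (suc m) g e zero    _         | true = ≤ᵇ⇒≤ _ _ (subst T (sym eq) _)
    unfold (suc m) g e (suc j) (s<s j<m) | true = unfold m (λ i → g (suc i)) e j j<m

-- Counting Boolean functions on finite lists.

Unique-lookup-injective : ∀ {A : Set} {xs : List A} → Unique xs → ∀ i j → lookup xs i ≡ lookup xs j → i ≡ j
Unique-lookup-injective (_ ∷ _) zero zero _ = refl
Unique-lookup-injective {xs = _ ∷ xs} (p ∷ _) zero (suc j) e = ⊥-elim (All.lookup p (∈-lookup {xs = xs} j) e)
Unique-lookup-injective {xs = _ ∷ xs} (p ∷ _) (suc i) zero e = ⊥-elim (All.lookup p (∈-lookup {xs = xs} i) (sym e))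
Unique-lookup-injective (_ ∷ u) (suc i) (suc j) e = cong suc (Unique-lookup-injective u i j e)

module _ {A B : Set} (_≟_ : DecidableEquality A) {xs : List A} {ys : List B} (uniq : Unique xs) where
  open DecMembership _≟_ using () renaming (_∈?_ to _∈ₗ?_)

  private
    bit : Fin 2 → Bool
    bit zero    = false
    bit (suc _) = true

    unbit : Bool → Fin 2
    unbit false = zero
    unbit true  = suc zero

    unbit-injective : ∀ {a b} → unbit a ≡ unbit b → a ≡ b
    unbit-injective {false} {false} _ = refl
    unbit-injective {true}  {true}  _ = refl

    bit-injective : ∀ {a b} → bit a ≡ bit b → a ≡ b
    bit-injective {zero}     {zero}     _ = refl
    bit-injective {suc zero} {suc zero} _ = refl

    extend : (Fin (length xs) → Fin 2) → A → Bool
    extend β a with a ∈ₗ? xs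
    ... | yes p = bit (β (Any.index p))
    -- The value off `xs` is arbitrary: functions are compared on `xs` only.
    ... | no _  = false

    extend-lookup : ∀ β i → extend β (lookup xs i) ≡ bit (β i)
    extend-lookup β i with lookup xs i ∈ₗ? xs
    ... | yes p = cong (λ j → bit (β j)) (Unique-lookup-injective uniq _ i (sym (lookup-index p)))
    ... | no ¬p = ⊥-elim (¬p (∈-lookup {xs = xs} i))

  -- Coding functions by numbers gives an injection from `2 ^ length xs` codes into `2 ^ length ys`
  -- codes. This stands in for comparing dimensions over the field with two elements.
  Bool-pigeonhole : (Φ : (A → Bool) → B → Bool) →
    (∀ f g → (∀ y → y ∈ₗ ys → Φ f y ≡ Φ g y) → ∀ x → x ∈ₗ xs → f x ≡ g x) →
    length xs ≤ length ys
  Bool-pigeonhole Φ inj = ≮⇒≥ λ len< → <⇒≱ (^-monoʳ-< 2 (s≤s (s≤s z≤n)) len<) (injective⇒≤ {f = code} code-injective)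
    where
    decode : Fin (2 ^ length xs) → A → Bool
    decode c = extend (finToFun c)
    code : Fin (2 ^ length xs) → Fin (2 ^ length ys)
    code c = funToFin (λ i → unbit (Φ (decode c) (lookup ys i)))
    code-injective : ∀ {a b} → code a ≡ code b → a ≡ b
    code-injective {a} {b} e = finToFun-injective λ i → bit-injective
        (trans (sym (extend-lookup (finToFun a) i)) (trans (inj (decode a) (decode b) same _ (∈-lookup {xs = xs} i))
               (extend-lookup (finToFun b) i)))
      where
      same : ∀ y → y ∈ₗ ys → Φ (decode a) y ≡ Φ (decode b) y
      same y p = subst (λ y → Φ (decode a) y ≡ Φ (decode b) y) (sym (lookup-index p)) (unbit-injective
        (trans (sym (finToFun-funToFin _ (Any.index p))) (trans (cong (λ c → finToFun c (Any.index p)) e) (finToFun-funToFin _ (Any.index p)))))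
      finToFun-injective : (∀ i → finToFun {2} {length xs} a i ≡ finToFun b i) → a ≡ b
      finToFun-injective h = trans (sym (funToFin-finToFin′ {length xs} a)) (trans (funToFin-cong _ _ h) (funToFin-finToFin′ {length xs} b))
        where
        funToFin-finToFin′ : ∀ {m} (k : Fin (2 ^ m)) → funToFin {m} (finToFun k) ≡ k
        funToFin-finToFin′ {m} k = funToFin-finToFin {m} {2} k
        funToFin-cong : ∀ {m} (f g : Fin m → Fin 2) → (∀ i → f i ≡ g i) → funToFin f ≡ funToFin g
        funToFin-cong {zero}  f g h = refl
        funToFin-cong {suc m} f g h = cong₂ combine (h zero) (funToFin-cong (λ i → f (suc i)) (λ i → g (suc i)) (λ i → h (suc i)))

-- Chains modulo 2

infix 7 _≡ᶠ_
_≡ᶠ_ : ∀ {m} → Fin m → Fin m → Bool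
x ≡ᶠ y = does (x ≟ y)

xor-cancelˡ : ∀ a {b c} → a xor b ≡ a xor c → b ≡ c
xor-cancelˡ false e = e
xor-cancelˡ true {false} {false} e = refl
xor-cancelˡ true {true}  {true}  e = refl

xor-cancelʳ : ∀ c {a b} → a xor c ≡ b xor c → a ≡ b
xor-cancelʳ c {a} {b} e = xor-cancelˡ c (trans (xor-comm c a) (trans e (xor-comm b c)))

xor-interchange : ∀ a b c d → (a xor b) xor (c xor d) ≡ (a xor c) xor (b xor d)
xor-interchange a b c d = trans (xor-assoc a b (c xor d)) (trans (cong (a xor_)
  (trans (sym (xor-assoc b c d)) (trans (cong (_xor d) (xor-comm b c)) (xor-assoc c b d)))) (sym (xor-assoc a c (b xor d))))

xor-telescope : ∀ a b c → (a xor b) xor (b xor c) ≡ a xor c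
xor-telescope a b c = trans (xor-assoc a b (b xor c)) (cong (a xor_) (trans (sym (xor-assoc b b c)) (cong (_xor c) (xor-same b))))

sum-false : ∀ m → sum {m} (λ _ → false) ≡ false
sum-false zero    = refl
sum-false (suc m) = sum-false m

sum-indicator : ∀ {m} (g : Fin m → Bool) x → sum (λ y → g y ∧ (y ≡ᶠ x)) ≡ g x
sum-indicator {suc m} g zero = trans (cong₂ _xor_ (∧-identityʳ (g zero))
  (trans (sum-cong-≗ {m} {λ y → g (suc y) ∧ false} (λ y → ∧-zeroʳ (g (suc y)))) (sum-false m))) (xor-identityʳ (g zero))
sum-indicator {suc m} g (suc x) = trans (cong (_xor sum (λ y → g (suc y) ∧ (y ≡ᶠ x))) (∧-zeroʳ (g zero))) (sum-indicator (g ∘ suc) x)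

length-cartesianProduct : ∀ {A B : Set} (xs : List A) (ys : List B) → length (cartesianProduct xs ys) ≡ length xs * length ys
length-cartesianProduct []       ys = refl
length-cartesianProduct (x ∷ xs) ys = trans (length-++ (map (x ,_) ys)) (cong₂ _+_ (length-map (x ,_) ys) (length-cartesianProduct xs ys))

module _ (G : PlaneGraph) where
  open PlaneGraph G

  φ-injective : ∀ {x y} → φ G x ≡ φ G y → x ≡ y
  φ-injective {x} {y} e = trans (sym (α-invol x)) (trans (cong α
    (trans (sym (σ⁻σ (α x))) (trans (cong σ⁻ e) (σ⁻σ (α y))))) (α-invol y))

  Within : (Fin n → Set) → Fin n → Fin n → Set
  Within P a b = P a × P b × Adj G a b

  ∂ : (Fin d → Bool) → Fin n → Bool
  ∂ u v = sum (λ y → tail y ≡ᶠ v ∧ u y)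

  -- It has two uses. On a function constant along faces it is the coboundary, the difference of the
  -- faces on the two sides of an edge; on the dart count of a walk it forgets the direction and
  -- yields an edge chain.
  δ : (Fin d → Bool) → Fin d → Bool
  δ h y = h y xor h (α y)

  count : ∀ {P u v} → Star (Within P) u v → Fin d → Bool
  count ε                       y = false
  count ((_ , _ , x , _) ◅ w) y = y ≡ᶠ x xor count w y

  chain : ∀ {P u v} → Star (Within P) u v → Fin d → Bool
  chain w = δ (count w)

  ∂-cong : ∀ {u u′} v → (∀ y → tail y ≡ v → u y ≡ u′ y) → ∂ u v ≡ ∂ u′ v
  ∂-cong {u} {u′} v e = sum-cong-≗ λ y → at y (tail y ≟ v)
    where
    at : ∀ y (t : Dec (tail y ≡ v)) → does t ∧ u y ≡ does t ∧ u′ y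
    at y (yes p) = e y p
    at y (no _)  = refl

  ∂-xor : ∀ u u′ v → ∂ (λ y → u y xor u′ y) v ≡ ∂ u v xor ∂ u′ v
  ∂-xor u u′ v = trans (sum-cong-≗ (λ y → ∧-distribˡ-xor (tail y ≡ᶠ v) (u y) (u′ y)))
    (∑-distrib-+ (λ y → tail y ≡ᶠ v ∧ u y) (λ y → tail y ≡ᶠ v ∧ u′ y))

  ∂-false : ∀ v → ∂ (λ _ → false) v ≡ false
  ∂-false v = trans (sum-cong-≗ (λ y → ∧-zeroʳ (tail y ≡ᶠ v))) (sum-false d)

  ∂-∧ : ∀ b u v → ∂ (λ y → b ∧ u y) v ≡ b ∧ ∂ u v
  ∂-∧ false u v = ∂-false v
  ∂-∧ true  u v = refl

  ∂-sum : ∀ {m} (F : Fin m → Fin d → Bool) v → ∂ (λ y → sum (λ w → F w y)) v ≡ sum (λ w → ∂ (F w) v)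
  ∂-sum F v = trans (sum-cong-≗ (λ y → *-distribˡ-sum (tail y ≡ᶠ v) (λ w → F w y))) (∑-comm (λ y w → tail y ≡ᶠ v ∧ F w y))

  ∂-indicator : ∀ x v → ∂ (_≡ᶠ x) v ≡ tail x ≡ᶠ v
  ∂-indicator x v = sum-indicator (λ y → tail y ≡ᶠ v) x

  α-≡ᶠ : ∀ y x → α y ≡ᶠ x ≡ y ≡ᶠ α x
  α-≡ᶠ y x = does-⇔ (mk⇔ (λ e → trans (sym (α-invol y)) (cong α e)) (λ e → trans (cong α e) (α-invol x))) (α y ≟ x) (y ≟ α x)

  δ-α : ∀ h y → δ h (α y) ≡ δ h y
  δ-α h y = trans (cong (h (α y) xor_) (cong h (α-invol y))) (xor-comm (h (α y)) (h y))

  ∂-chain : ∀ {P u v} (w : Star (Within P) u v) x → ∂ (chain w) x ≡ u ≡ᶠ x xor v ≡ᶠ x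
  ∂-chain {u = u} ε x = trans (∂-false x) (sym (xor-same (u ≡ᶠ x)))
  ∂-chain {u = u} {v} ((_ , _ , e , refl , refl) ◅ w) x =
    trans (∂-cong x (λ y _ → xor-interchange (y ≡ᶠ e) (count w y) (α y ≡ᶠ e) (count w (α y))))
    (trans (∂-xor _ (chain w) x)
    (trans (cong₂ _xor_ (trans (∂-xor _ _ x) (cong₂ _xor_ (∂-indicator e x) (trans (∂-cong x (λ y _ → α-≡ᶠ y e)) (∂-indicator (α e) x))))
                        (∂-chain w x))
           (xor-telescope (tail e ≡ᶠ x) (tail (α e) ≡ᶠ x) (v ≡ᶠ x))))

  -- As `φ (α y)` is `σ y`, the value of `h` at `α y` equals that at `σ y`. Rotation permutes the
  -- darts at `v`, so the two halves of `δ h` have equal sums there and cancel.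
  ∂-δ : ∀ h → (∀ y → h (φ G y) ≡ h y) → ∀ v → ∂ (δ h) v ≡ false
  ∂-δ h hφ v = trans (∂-xor h (h ∘ α) v) (trans (cong (∂ h v xor_) rotate) (xor-same (∂ h v)))
    where
    σ-perm : Permutation′ d
    σ-perm = permutation σ σ⁻ (λ x → σσ⁻ x) (λ x → σ⁻σ x)
    rotate : ∂ (h ∘ α) v ≡ ∂ h v
    rotate = trans (sum-cong-≗ (λ y → cong₂ _∧_ (cong (_≡ᶠ v) (sym (σ-tail y)))
                     (trans (sym (hφ (α y))) (cong (h ∘ σ) (α-invol y)))))
                   (sym (sum-permute (λ y → tail y ≡ᶠ v ∧ h y) σ-perm))

  -- The darts at a vertex form one `σ`-orbit and `α` crosses an edge. Invariance of `Q` is demanded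
  -- only at vertices in `P`, so it may fail away from the walk.
  dart-walk : ∀ {P : Fin n → Set} (Q : Fin d → Set) →
              (∀ {x} → P (tail x) → Q x → Q (σ x)) → (∀ {x} → P (tail x) → Q x → Q (α x)) →
              ∀ {u v} → Star (Within P) u v → P u → ∀ x y → tail x ≡ u → tail y ≡ v → Q x → Q y
  dart-walk {P} Q Qσ Qα = along
    where
    rotate : ∀ i x → P (tail x) → Q x → Q (iter σ i x)
    rotate zero    x p q = q
    rotate (suc i) x p q = Qσ (subst P (sym (iter-preserves σ tail σ-tail i x)) p) (rotate i x p q)
    around : ∀ x y → tail x ≡ tail y → P (tail x) → Q x → Q y
    around x y e p q with σ-trans x y e
    ... | i , refl = rotate i x p q
    along : ∀ {u v} → Star (Within P) u v → P u → ∀ x y → tail x ≡ u → tail y ≡ v → Q x → Q y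
    along ε p x y refl e q = around x y (sym e) p q
    along ((_ , p′ , z , refl , f) ◅ w) p x y e₁ e₂ q =
      along w p′ (α z) y f e₂ (Qα p (around x z e₁ (subst P (sym e₁) p) q))

  dart-connected : (Q : Fin d → Set) → (∀ {x} → Q x → Q (σ x)) → (∀ {x} → Q x → Q (α x)) →
                   ∀ x y → comp (tail x) ≡ comp (tail y) → Q x → Q y
  dart-connected Q Qσ Qα x y e =
    dart-walk Q (λ _ → Qσ) (λ _ → Qα) (Star.map (λ a → tt , tt , a) (comp-conn _ _ e)) tt x y refl refl

  -- Even chains and Euler's formula.

  module _ {k : Fin c} {o : Fin d} (outer : outerDart k ≡ just o)
           {z : Fin d → Bool} (z-α : ∀ y → z (α y) ≡ z y) (∂z : ∀ v → ∂ z v ≡ false) where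

    private
      root : Fin n
      root = tail o

      comp-root : comp root ≡ k
      comp-root = outerDart-just k o outer

      rootWalk : ∀ v → comp v ≡ k → Star (Within (λ _ → ⊤)) root v
      rootWalk v e = Star.map (λ a → tt , tt , a) (comp-conn root v (trans comp-root (sym e)))

      path : Fin n → Fin d → Bool
      path v with comp v ≟ k
      ... | yes e = chain (rootWalk v e)
      ... | no _  = λ _ → false

      path-α : ∀ v y → path v (α y) ≡ path v y
      path-α v y with comp v ≟ k
      ... | yes e = δ-α (count (rootWalk v e)) y
      ... | no _  = refl

      ∂-path : ∀ v x → comp x ≡ k → root ≢ x → ∂ (path v) x ≡ v ≡ᶠ x
      ∂-path v x x∈k r≢x with comp v ≟ k
      ... | yes e = trans (∂-chain (rootWalk v e) x) (cong (_xor v ≡ᶠ x) (dec-false (root ≟ x) r≢x))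
      ... | no v∉k = trans (∂-false x) (sym (dec-false (v ≟ x) (λ { refl → v∉k x∈k })))

      -- A linear section of the boundary map, built from fixed walks out of the root. It controls
      -- the boundary everywhere in the component except at the root.
      lift : (Fin n → Bool) → Fin d → Bool
      lift s y = sum (λ v → s v ∧ path v y)

      ∂-lift : ∀ s x → comp x ≡ k → root ≢ x → ∂ (lift s) x ≡ s x
      ∂-lift s x x∈k r≢x = trans (∂-sum (λ v y → s v ∧ path v y) x)
        (trans (sum-cong-≗ (λ v → trans (∂-∧ (s v) (path v) x) (cong (s v ∧_) (∂-path v x x∈k r≢x)))) (sum-indicator s x))

      -- The unknowns are a multiple of `z`, a charge for each vertex and a potential for each face.
      -- They are taken in two copies because Euler's formula is stated with darts, two for each
      -- edge.
      Coordinate : Set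
      Coordinate = Bool × (⊤ ⊎ (Fin n ⊎ Fin d))

      pattern scalar   = inj₁ tt
      pattern vertex v = inj₂ (inj₁ v)
      pattern face y   = inj₂ (inj₂ y)

      potential : (Coordinate → Bool) → Bool → Fin d → Bool
      potential f b y = f (b , face (orbitRep (φ G) φ-injective y))

      potential-φ : ∀ f b y → potential f b (φ G y) ≡ potential f b y
      potential-φ f b y = cong (λ r → f (b , face r)) (orbitRep-∘ (φ G) φ-injective y)

      charge : (Coordinate → Bool) → Bool → Fin n → Bool
      charge f b v = f (b , vertex v)

      combination : (Coordinate → Bool) → Bool → Fin d → Bool
      combination f b y = (f (b , scalar) ∧ z y) xor (δ (potential f b) y xor lift (charge f b) y)

      combination-α : ∀ f b y → combination f b (α y) ≡ combination f b y
      combination-α f b y = cong₂ _xor_ (cong (f (b , scalar) ∧_) (z-α y))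
        (cong₂ _xor_ (δ-α (potential f b) y) (sum-cong-≗ (λ v → cong (charge f b v ∧_) (path-α v y))))

      ∂-combination : ∀ f b x → comp x ≡ k → root ≢ x → ∂ (combination f b) x ≡ charge f b x
      ∂-combination f b x x∈k r≢x = trans (∂-xor _ _ x) (cong₂ _xor_
        (trans (∂-∧ (f (b , scalar)) z x) (trans (cong (f (b , scalar) ∧_) (∂z x)) (∧-zeroʳ _)))
        (trans (∂-xor _ _ x) (cong₂ _xor_ (∂-δ (potential f b) (potential-φ f b) x) (∂-lift (charge f b) x x∈k r≢x))))

      -- Each edge has two darts, which store the values of two independent chains.
      encode : (Coordinate → Bool) → Fin d ⊎ (Bool × Bool) → Bool
      encode f (inj₁ y)           = combination f (toℕ y <ᵇ toℕ (α y)) y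
      encode f (inj₂ (b , false)) = charge f b root
      encode f (inj₂ (b , true))  = potential f b o

      vertices : List (Fin n)
      vertices = filter (λ v → ⌊ comp v ≟ k ⌋ Bool.≟ true) (allFin n)

      faces darts : List (Fin d)
      faces = filter (λ y → (⌊ comp (tail y) ≟ k ⌋ ∧ isOrbitRep (φ G) y) Bool.≟ true) (allFin d)
      darts = filter (λ y → ⌊ comp (tail y) ≟ k ⌋ Bool.≟ true) (allFin d)

      bools : List Bool
      bools = false ∷ true ∷ []

      coordinates : List Coordinate
      coordinates = cartesianProduct bools (scalar ∷ map inj₂ (map inj₁ vertices ++ map inj₂ faces))

      -- The four outputs besides the darts record, for each copy, the charge at the root and the
      -- potential at the outer dart: these are what boundary and coboundary leave undetermined.
      outputs : List (Fin d ⊎ (Bool × Bool))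
      outputs = map inj₁ darts ++ map inj₂ (cartesianProduct bools bools)

      coordinates-unique : Unique coordinates
      coordinates-unique = Unique.cartesianProduct⁺ (((λ ()) ∷ []) ∷ [] ∷ [])
        (All.tabulate (λ p e → case-map (∈-map⁻ inj₂ p) e)
          ∷ Unique.map⁺ Sum.inj₂-injective
              (Unique.++⁺ (Unique.map⁺ Sum.inj₁-injective (Unique.filter⁺ _ (Unique.allFin⁺ n)))
                          (Unique.map⁺ Sum.inj₂-injective (Unique.filter⁺ _ (Unique.allFin⁺ d)))
                          (λ { (p , q) → clash (∈-map⁻ inj₁ p) (∈-map⁻ inj₂ q) })))
        where
        case-map : ∀ {A B : Set} {x : A} {y : A ⊎ B} {ys : List B} → ∃[ b ] (b ∈ₗ ys × y ≡ inj₂ b) → inj₁ x ≡ y → ⊥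
        case-map (_ , _ , refl) ()
        clash : ∀ {A B : Set} {y : A ⊎ B} {xs : List A} {ys : List B} →
                ∃[ a ] (a ∈ₗ xs × y ≡ inj₁ a) → ∃[ b ] (b ∈ₗ ys × y ≡ inj₂ b) → ⊥
        clash (_ , _ , refl) (_ , _ , ())

      length-coordinates : length coordinates ≡ 2 * suc (length vertices + length faces)
      length-coordinates = trans (length-cartesianProduct bools (scalar ∷ map inj₂ (map inj₁ vertices ++ map inj₂ faces)))
        (cong (λ l → 2 * suc l) (trans (length-map inj₂ (map inj₁ vertices ++ map inj₂ faces))
          (trans (length-++ (map inj₁ vertices)) (cong₂ _+_ (length-map inj₁ vertices) (length-map inj₂ faces)))))

      length-outputs : length outputs ≡ length darts + 4
      length-outputs = trans (length-++ (map inj₁ darts)) (cong (_+ 4) (length-map inj₁ darts))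

      -- By Euler's formula vertices and faces alone, in two copies, match the outputs exactly; the
      -- two `scalar` coordinates are the excess.
      too-many : length outputs < length coordinates
      too-many rewrite length-coordinates | length-outputs
                     | *-suc 2 (length vertices + length faces) | euler k o outer = s≤s (m≤n+m _ 1)

      bool∈ : ∀ b → b ∈ₗ bools
      bool∈ false = here refl
      bool∈ true  = there (here refl)

      isYes-true : ∀ {A : Set} (a? : Dec A) → A → ⌊ a? ⌋ ≡ true
      isYes-true a? a = trans (isYes≗does a?) (dec-true a? a)

      dart∈ : ∀ y → comp (tail y) ≡ k → inj₁ y ∈ₗ outputs
      dart∈ y e = ∈-++⁺ˡ (∈-map⁺ inj₁ (∈-filter⁺ _ (∈-allFin y) (isYes-true (comp (tail y) ≟ k) e)))

      extra∈ : ∀ b b′ → inj₂ (b , b′) ∈ₗ outputs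
      extra∈ b b′ = ∈-++⁺ʳ (map inj₁ darts) (∈-map⁺ inj₂ (∈-cartesianProduct⁺ (bool∈ b) (bool∈ b′)))

      comp-α : ∀ {y} → comp (tail y) ≡ k → comp (tail (α y)) ≡ k
      comp-α {y} = trans (comp-edge y)

    -- Euler's formula says that the dimensions of the coboundaries of face potentials and of
    -- the boundaries of chains add up to the number of edges.
    even-chain-is-coboundary : ¬ ¬ (∃[ h ] ((∀ y → h (φ G y) ≡ h y) × (∀ y → comp (tail y) ≡ k → δ h y ≡ z y)))
    even-chain-is-coboundary none = <⇒≱ too-many
        -- If no potential existed, `encode` would be injective on too many coordinates.
        (Bool-pigeonhole (Product.≡-dec Bool._≟_ (Sum.≡-dec Unit._≟_ (Sum.≡-dec _≟_ _≟_))) coordinates-unique encode encode-injective)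
      where
      module _ (f g : Coordinate → Bool) (same : ∀ y → y ∈ₗ outputs → encode f y ≡ encode g y) where

        -- Exactly one of the two darts of an edge stores copy `b`; symmetry under `α` carries the
        -- equality to the other.
        same-combination : ∀ b y → comp (tail y) ≡ k → combination f b y ≡ combination g b y
        same-combination b y y∈k with (toℕ y <ᵇ toℕ (α y)) Bool.≟ b
        ... | yes refl = same (inj₁ y) (dart∈ y y∈k)
        ... | no b≢ = trans (sym (combination-α f b y)) (trans at-α (combination-α g b y))
          where
          flip : ∀ {b} → (toℕ y <ᵇ toℕ (α y)) ≢ b → (toℕ (α y) <ᵇ toℕ (α (α y))) ≡ b
          flip {b} b≢ rewrite α-invol y with <-cmp (toℕ y) (toℕ (α y)) | toℕ y <ᵇ toℕ (α y) in e₁ | toℕ (α y) <ᵇ toℕ y in e₂ | b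
          ... | tri≈ _ e _ | _     | _     | _     = ⊥-elim (noLoop y (cong tail (sym (toℕ-injective e))))
          ... | tri< l _ _ | false | _     | _     = ⊥-elim (subst T e₁ (<⇒<ᵇ l))
          ... | tri< l _ _ | true  | true  | _     = ⊥-elim (<-asym l (<ᵇ⇒< _ _ (subst T (sym e₂) tt)))
          ... | tri< l _ _ | true  | false | true  = ⊥-elim (b≢ refl)
          ... | tri< l _ _ | true  | false | false = refl
          ... | tri> _ _ l | _     | false | _     = ⊥-elim (subst T e₂ (<⇒<ᵇ l))
          ... | tri> _ _ l | true  | true  | _     = ⊥-elim (<-asym l (<ᵇ⇒< _ _ (subst T (sym e₁) tt)))
          ... | tri> _ _ l | false | true  | false = ⊥-elim (b≢ refl)
          ... | tri> _ _ l | false | true  | true  = refl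
          at-α : combination f b (α y) ≡ combination g b (α y)
          at-α = subst (λ b → combination f b (α y) ≡ combination g b (α y)) (flip b≢) (same (inj₁ (α y)) (dart∈ (α y) (comp-α y∈k)))

        -- Off the root the boundary of the combination is the charge, since neither `z` nor the
        -- coboundary contributes. At the root the charge is an output.
        same-charge : ∀ b v → comp v ≡ k → charge f b v ≡ charge g b v
        same-charge b v v∈k with root ≟ v
        ... | yes refl = same _ (extra∈ b false)
        ... | no r≢v = trans (sym (∂-combination f b v v∈k r≢v))
          (trans (∂-cong v (λ y e → same-combination b y (trans (cong comp e) v∈k))) (∂-combination g b v v∈k r≢v))

        same-lift : ∀ b y → lift (charge f b) y ≡ lift (charge g b) y
        same-lift b y = sum-cong-≗ at
          where
          at : ∀ v → charge f b v ∧ path v y ≡ charge g b v ∧ path v y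
          at v with comp v ≟ k
          ... | yes e = cong (_∧ _) (same-charge b v e)
          ... | no ≢k = trans (∧-zeroʳ _) (sym (∧-zeroʳ _))

        same-rest : ∀ b y → comp (tail y) ≡ k → (f (b , scalar) ∧ z y) xor δ (potential f b) y ≡ (g (b , scalar) ∧ z y) xor δ (potential g b) y
        same-rest b y y∈k = xor-cancelʳ (lift (charge f b) y) (trans (xor-assoc (f (b , scalar) ∧ z y) _ _)
          (trans (same-combination b y y∈k) (trans (sym (xor-assoc (g (b , scalar) ∧ z y) _ _))
            (cong (((g (b , scalar) ∧ z y) xor δ (potential g b) y) xor_) (sym (same-lift b y))))))

        difference : Bool → Fin d → Bool
        difference b y = potential f b y xor potential g b y

        difference-φ : ∀ b y → difference b (φ G y) ≡ difference b y
        difference-φ b y = cong₂ _xor_ (potential-φ f b y) (potential-φ g b y)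

        δ-difference : ∀ b y → δ (difference b) y ≡ δ (potential f b) y xor δ (potential g b) y
        δ-difference b y = xor-interchange (potential f b y) (potential g b y) (potential f b (α y)) (potential g b (α y))

        -- If the scalars differed, the difference of the two potentials would have coboundary `z`,
        -- which `none` forbids.
        same-scalar : ∀ b → f (b , scalar) ≡ g (b , scalar)
        same-scalar b with f (b , scalar) | g (b , scalar) | same-rest b
        ... | false | false | _ = refl
        ... | true  | true  | _ = refl
        ... | true  | false | rest = ⊥-elim (none (difference b , difference-φ b , λ y e → trans (δ-difference b y) (solve₁ _ _ _ (rest y e))))
          where
          solve₁ : ∀ a b c → a xor b ≡ c → b xor c ≡ a
          solve₁ a b c refl = trans (cong (b xor_) (xor-comm a b)) (trans (sym (xor-assoc b b a)) (cong (_xor a) (xor-same b)))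
        ... | false | true  | rest = ⊥-elim (none (difference b , difference-φ b , λ y e → trans (δ-difference b y) (solve₂ _ _ _ (rest y e))))
          where
          solve₂ : ∀ a b c → b ≡ a xor c → b xor c ≡ a
          solve₂ a b c refl = trans (xor-assoc a c c) (trans (cong (a xor_) (xor-same c)) (xor-identityʳ a))

        difference-closed : ∀ b y → comp (tail y) ≡ k → difference b (α y) ≡ difference b y
        difference-closed b y y∈k = sym (xor-cancelʳ (difference b (α y)) (trans (δ-difference b y)
          (trans (cong (_xor δ (potential g b) y) same-δ) (trans (xor-same (δ (potential g b) y)) (sym (xor-same (difference b (α y))))))))
          where
          same-δ : δ (potential f b) y ≡ δ (potential g b) y
          same-δ = xor-cancelˡ (f (b , scalar) ∧ z y) (trans (same-rest b y y∈k)
            (cong (λ a → (a ∧ z y) xor δ (potential g b) y) (sym (same-scalar b))))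

        -- The difference of the potentials is invariant under `φ` and `α`, hence under `σ`, so it
        -- is constant on the component; it vanishes at the outer dart.
        same-potential : ∀ b y → comp (tail y) ≡ k → potential f b y ≡ potential g b y
        same-potential b y y∈k = xor-cancelʳ (potential g b y) (trans (proj₂ (dart-connected Q
            (λ { {x} (x∈k , q) → trans (cong comp (σ-tail x)) x∈k ,
                   trans (cong (difference b ∘ σ) (sym (α-invol x))) (trans (difference-φ b (α x)) (trans (difference-closed b x x∈k) q)) })
            (λ { {x} (x∈k , q) → comp-α x∈k , trans (difference-closed b x x∈k) q })
            o y (trans comp-root (sym y∈k))
            (comp-root , trans (cong (_xor potential g b o) (same _ (extra∈ b true))) (xor-same (potential g b o)))))
          (sym (xor-same (potential g b y))))
          where
          Q : Fin d → Set
          Q x = comp (tail x) ≡ k × difference b x ≡ false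

      from-isYes : ∀ {A : Set} (a? : Dec A) → ⌊ a? ⌋ ≡ true → A
      from-isYes a? e = toWitness {a? = a?} (subst T (sym e) tt)

      ∧-true : ∀ {a b} → a ∧ b ≡ true → a ≡ true × b ≡ true
      ∧-true {true} e = refl , e

      encode-injective : ∀ f g → (∀ y → y ∈ₗ outputs → encode f y ≡ encode g y) → ∀ x → x ∈ₗ coordinates → f x ≡ g x
      encode-injective f g same (b , i) p with ∈-cartesianProduct⁻ bools (scalar ∷ map inj₂ (map inj₁ vertices ++ map inj₂ faces)) p
      ... | _ , here refl = same-scalar f g same b
      ... | _ , there q with ∈-map⁻ inj₂ q
      ... | _ , q′ , refl with ∈-++⁻ (map inj₁ vertices) q′
      ... | inj₁ r with ∈-map⁻ inj₁ r
      ...   | v , r′ , refl = same-charge f g same b v (from-isYes (comp v ≟ k) (proj₂ (∈-filter⁻ _ {xs = allFin n} r′)))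
      encode-injective f g same (b , i) p | _ , there q | _ , q′ , refl | inj₂ r with ∈-map⁻ inj₂ r
      ... | y , r′ , refl with ∧-true (proj₂ (∈-filter⁻ (λ y → (⌊ comp (tail y) ≟ k ⌋ ∧ isOrbitRep (φ G) y) Bool.≟ true) {xs = allFin d} r′))
      ... | y∈k , rep = subst (λ r → f (b , face r) ≡ g (b , face r)) (orbitRep-isOrbitRep (φ G) φ-injective y rep)
                          (same-potential f g same b y (from-isYes (comp (tail y) ≟ k) y∈k))

module _ (G : PlaneGraph) where
  open PlaneGraph G

  Apart : (Fin n → Set) → (Fin n → Set) → Set
  Apart P Q = ∀ v → P v → Q v → ⊥

  Adj-sym : ∀ {u v} → Adj G u v → Adj G v u
  Adj-sym (x , refl , refl) = α x , refl , cong tail (α-invol x)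

  Within-map : ∀ {P Q : Fin n → Set} → (∀ {v} → P v → Q v) → ∀ {u v} → Star (Within G P) u v → Star (Within G Q) u v
  Within-map i = Star.map λ (p , q , a) → i p , i q , a

  Within-reverse : ∀ {P : Fin n → Set} {u v} → Star (Within G P) u v → Star (Within G P) v u
  Within-reverse = Star.reverse λ (p , q , a) → q , p , Adj-sym a

  -- Walks crossing on a face

  count-◅◅ : ∀ {P u v w} (a : Star (Within G P) u v) (b : Star (Within G P) v w) y →
             count G (a ◅◅ b) y ≡ count G a y xor count G b y
  count-◅◅ ε b y = refl
  count-◅◅ ((_ , _ , x , _) ◅ a) b y = trans (cong ((y ≡ᶠ x) xor_) (count-◅◅ a b y)) (sym (xor-assoc (y ≡ᶠ x) (count G a y) (count G b y)))

  chain-outside : ∀ {P u v} (w : Star (Within G P) u v) y → ¬ P (tail y) → chain G w y ≡ false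
  chain-outside ε y ∉P = refl
  chain-outside {P} ((p , q , x , refl , refl) ◅ w) y ∉P = trans
    (xor-interchange (y ≡ᶠ x) (count G w y) (α y ≡ᶠ x) (count G w (α y)))
    (cong₂ _xor_ (cong₂ _xor_ (dec-false (y ≟ x) λ { refl → ∉P p })
                              (dec-false (α y ≟ x) λ { refl → ∉P (subst P (cong tail (α-invol y)) q) }))
                 (chain-outside w y ∉P))

  faceWalk : ∀ j x → Star (Within G (λ _ → ⊤)) (tail x) (tail (iter (φ G) j x))
  faceWalk zero    x = ε
  faceWalk (suc j) x = faceWalk j x ◅◅ ((tt , tt , y , refl , sym (σ-tail (α y))) ◅ ε)
    where y = iter (φ G) j x

  count-faceWalk : ∀ j x y → count G (faceWalk (suc j) x) y ≡ count G (faceWalk j x) y xor y ≡ᶠ iter (φ G) j x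
  count-faceWalk j x y = trans (count-◅◅ (faceWalk j x) _ y) (cong (count G (faceWalk j x) y xor_) (xor-identityʳ _))

  -- The walk uses consecutive darts of one `φ`-orbit, so modulo 2 the count changes between `y` and
  -- its successor only where the walk starts or stops.
  count-faceWalk-φ : ∀ j x y → count G (faceWalk j x) (φ G y) xor count G (faceWalk j x) y
                             ≡ φ G y ≡ᶠ x xor φ G y ≡ᶠ iter (φ G) j x
  count-faceWalk-φ zero    x y = sym (xor-same (φ G y ≡ᶠ x))
  count-faceWalk-φ (suc j) x y = trans (cong₂ _xor_ (count-faceWalk j x (φ G y)) (count-faceWalk j x y))
    (trans (xor-interchange (count G (faceWalk j x) (φ G y)) _ _ _)
    (trans (cong₂ _xor_ (count-faceWalk-φ j x y) (cong (φ G y ≡ᶠ z xor_) shift))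
           (xor-telescope (φ G y ≡ᶠ x) (φ G y ≡ᶠ z) _)))
    where
    z = iter (φ G) j x
    shift : y ≡ᶠ z ≡ φ G y ≡ᶠ φ G z
    shift = does-⇔ (mk⇔ (cong (φ G)) (φ-injective G)) (y ≟ z) (φ G y ≟ φ G z)

  count-faceWalk-off : ∀ j x y → (∀ m → m < j → iter (φ G) m x ≢ y) → count G (faceWalk j x) y ≡ false
  count-faceWalk-off zero    x y off = refl
  count-faceWalk-off (suc j) x y off = trans (count-faceWalk j x y)
    (cong₂ _xor_ (count-faceWalk-off j x y λ m m<j → off m (<-trans m<j (n<1+n j)))
                 (dec-false (y ≟ iter (φ G) j x) λ e → off j (n<1+n j) (sym e)))

  count-faceWalk-on : ∀ i j x → (∀ i m → i < m → m < j → iter (φ G) i x ≢ iter (φ G) m x) → i < j →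
                      count G (faceWalk j x) (iter (φ G) i x) ≡ true
  count-faceWalk-on i (suc j) x inj i<1+j with m<1+n⇒m<n∨m≡n i<1+j
  ... | inj₁ i<j = trans (count-faceWalk j x (iter (φ G) i x)) (cong₂ _xor_
          (count-faceWalk-on i j x (λ i m i<m m<j → inj i m i<m (<-trans m<j (n<1+n j))) i<j)
          (dec-false (iter (φ G) i x ≟ iter (φ G) j x) (inj i j i<j (n<1+n j))))
  ... | inj₂ refl = trans (count-faceWalk j x (iter (φ G) i x)) (cong₂ _xor_
          (count-faceWalk-off j x _ λ m m<j → inj m j m<j (n<1+n j))
          (dec-true (iter (φ G) i x ≟ iter (φ G) j x) refl))

  -- Close the first walk along the face and let h be a potential of this closed chain.
  -- Adding the dart count of the face walk to h gives a function that is constant along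
  -- the second walk, but differs at its two ends.
  no-crossing : ∀ {k o} → outerDart k ≡ just o →
    ∀ {P Q : Fin n → Set} → Apart P Q → ∀ x → comp (tail x) ≡ k → ∀ {i j l} → i < j → j < l →
    (∀ m → m < l → iter (φ G) m x ≢ iter (φ G) l x) →
    P (tail x) → P (tail (iter (φ G) j x)) → Star (Within G P) (tail x) (tail (iter (φ G) j x)) →
    Q (tail (iter (φ G) i x)) → Star (Within G Q) (tail (iter (φ G) i x)) (tail (iter (φ G) l x)) → ⊥
  no-crossing {k} outer {P} {Q} apart x x∈k {i} {j} {l} i<j j<l first px pj A qi B =
    even-chain-is-coboundary G outer (λ y → cong₂ _xor_ (δ-α G (count G A) y) (δ-α G (count G F) y)) ∂z no-potential
    where
    F = faceWalk j x

    ∂z : ∀ v → ∂ G (λ y → chain G A y xor chain G F y) v ≡ false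
    ∂z v = trans (∂-xor G (chain G A) (chain G F) v)
      (trans (cong₂ _xor_ (∂-chain G A v) (∂-chain G F v)) (xor-same (tail x ≡ᶠ v xor tail (iter (φ G) j x) ≡ᶠ v)))

    distinct : ∀ a b → a < b → b ≤ l → iter (φ G) a x ≢ iter (φ G) b x
    distinct = first-visit-injective (φ G) (φ-injective G) x l first

    no-potential : ¬ (∃[ h ] ((∀ y → h (φ G y) ≡ h y) × (∀ y → comp (tail y) ≡ k → δ G h y ≡ chain G A y xor chain G F y)))
    -- The potential `h` agrees at the darts `i` and `l` of the face, but the face walk of length
    -- `j` uses the dart `i` and not the dart `l`.
    no-potential (h , hφ , hδ) = true≢false (trans (sym (count-faceWalk-on i j x (λ a b a<b b<j → distinct a b a<b (<⇒≤ (<-trans b<j j<l))) i<j))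
      (trans (xor-cancelˡ (h (iter (φ G) i x)) (trans (sym constant) (cong (_xor count G F _) (trans (iter-preserves (φ G) h hφ l x) (sym (iter-preserves (φ G) h hφ i x))))))
             (count-faceWalk-off j x _ λ m m<j → first m (<-trans m<j j<l))))
      where
      true≢false : true ≢ false
      true≢false ()

      f : Fin d → Bool
      f y = h y xor count G F y

      -- The count of the face walk jumps only at its two ends, and their tails lie in `P`.
      f-φ : ∀ y → Q (tail (φ G y)) → f (φ G y) ≡ f y
      f-φ y q = xor-cancelʳ (f y) (trans (xor-interchange (h (φ G y)) _ (h y) _)
        (trans (cong₂ _xor_ (trans (cong (_xor h y) (hφ y)) (xor-same (h y))) (trans (count-faceWalk-φ j x y)
          (cong₂ _xor_ (dec-false (φ G y ≟ x) λ { refl → apart _ px q })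
                       (dec-false (φ G y ≟ iter (φ G) j x) λ e → apart _ pj (subst (Q ∘ tail) e q)))))
          (sym (xor-same (f y)))))

      -- The first walk uses no edge at a vertex of `Q`, so there `δ h` reduces to the chain of the
      -- face walk, which cancels.
      f-α : ∀ y → comp (tail y) ≡ k → Q (tail y) → f (α y) ≡ f y
      f-α y y∈k q = sym (xor-cancelʳ (f (α y)) (trans (xor-interchange (h y) _ (h (α y)) _)
        (trans (cong (_xor chain G F y) (hδ y y∈k))
        (trans (xor-assoc (chain G A y) _ _) (trans (cong₂ _xor_ (chain-outside A y λ p → apart _ p q) (xor-same (chain G F y)))
          (sym (xor-same (f (α y)))))))))

      tail-φ : ∀ m → comp (tail (iter (φ G) m x)) ≡ k
      tail-φ m = trans (iter-preserves (φ G) (comp ∘ tail) (λ y → trans (cong comp (σ-tail (α y))) (comp-edge y)) m x) x∈k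

      constant : f (iter (φ G) l x) ≡ f (iter (φ G) i x)
      constant = proj₂ (dart-walk G (λ y → comp (tail y) ≡ k × f y ≡ f (iter (φ G) i x))
        (λ { {y} q (y∈k , e) → trans (cong comp (σ-tail y)) y∈k ,
             trans (trans (cong (f ∘ σ) (sym (α-invol y))) (trans (f-φ (α y) (subst Q (sym (trans (cong (tail ∘ σ) (α-invol y)) (σ-tail y))) q)) (f-α y y∈k q))) e })
        (λ { {y} q (y∈k , e) → trans (comp-edge y) y∈k , trans (f-α y y∈k q) e })
        B qi (iter (φ G) i x) (iter (φ G) l x) refl refl (tail-φ i , refl))

  -- In the application `S` is the inner ball, `M` the piece and `P` a spine. Taking first visits
  -- makes the indices positions on the face, read from `x`. Two walks from the end of the spoke
  -- replace connectedness of `P`.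
  record Spoke (x : Fin d) (S M P : Fin n → Set) : Set where
    field
      index   : ℕ
      first   : ∀ m → m < index → iter (φ G) m x ≢ iter (φ G) index x
      end∈P   : P (tail (iter (φ G) index x))
      to-S    : Star (Within G (P ∪ S)) (tail (iter (φ G) index x)) (tail x)
      entry   : Fin n
      entry∈M : M entry
      to-M    : Star (Within G (P ∪ M)) (tail (iter (φ G) index x)) entry

  module _ {k o} (outer : outerDart k ≡ just o) {x} (x∈k : comp (tail x) ≡ k)
           {S M : Fin n → Set} (x∈S : S (tail x)) (S∩M : Apart S M)
           (M-connected : ∀ {a b} → M a → M b → Star (Within G M) a b) where
    open Spoke

    private
      -- The darts at positions 0, `index s₁`, `index s₂`, `index s₃` belong alternately to `P₂ ∪ S`
      -- and to the union of `P₁`, `M` and `P₃`.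
      no-three-ordered : ∀ {P₁ P₂ P₃} (s₁ : Spoke x S M P₁) (s₂ : Spoke x S M P₂) (s₃ : Spoke x S M P₃) →
        Apart P₁ S → Apart P₂ M → Apart P₃ S → Apart P₁ P₂ → Apart P₂ P₃ →
        index s₁ < index s₂ → index s₂ < index s₃ → ⊥
      no-three-ordered {P₁} {P₂} {P₃} s₁ s₂ s₃ a1S a2M a3S a12 a23 i<j j<l =
        no-crossing outer {P₂ ∪ S} {P₁ ∪ (M ∪ P₃)} apart x x∈k i<j j<l (first s₃)
          (inj₂ x∈S) (inj₁ (end∈P s₂)) (Within-reverse (to-S s₂)) (inj₁ (end∈P s₁))
          (Within-map (λ { (inj₁ p) → inj₁ p ; (inj₂ m) → inj₂ (inj₁ m) }) (to-M s₁) ◅◅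
           Within-map (inj₂ ∘ inj₁) (M-connected (entry∈M s₁) (entry∈M s₃)) ◅◅
           Within-map (λ { (inj₁ p) → inj₂ (inj₂ p) ; (inj₂ m) → inj₂ (inj₁ m) }) (Within-reverse (to-M s₃)))
        where
        apart : Apart (P₂ ∪ S) (P₁ ∪ (M ∪ P₃))
        apart v (inj₁ p) (inj₁ q)        = a12 v q p
        apart v (inj₁ p) (inj₂ (inj₁ m)) = a2M v p m
        apart v (inj₁ p) (inj₂ (inj₂ q)) = a23 v p q
        apart v (inj₂ s) (inj₁ q)        = a1S v q s
        apart v (inj₂ s) (inj₂ (inj₁ m)) = S∩M v s m
        apart v (inj₂ s) (inj₂ (inj₂ q)) = a3S v q s

      index-≢ : ∀ {P Q} (s : Spoke x S M P) (t : Spoke x S M Q) → Apart P Q → index s ≢ index t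
      index-≢ {Q = Q} s t PQ e = PQ _ (end∈P s) (subst (λ m → Q (tail (iter (φ G) m x))) (sym e) (end∈P t))

    -- Disjoint spokes end at different positions; sorting the positions decides which spoke is the
    -- middle one.
    no-three-spokes : ∀ {P₁ P₂ P₃} → Spoke x S M P₁ → Spoke x S M P₂ → Spoke x S M P₃ →
      Apart P₁ S → Apart P₂ S → Apart P₃ S → Apart P₁ M → Apart P₂ M → Apart P₃ M →
      Apart P₁ P₂ → Apart P₁ P₃ → Apart P₂ P₃ → ⊥
    no-three-spokes s₁ s₂ s₃ a1S a2S a3S a1M a2M a3M a12 a13 a23
      with <-cmp (index s₁) (index s₂) | <-cmp (index s₂) (index s₃) | <-cmp (index s₁) (index s₃)
    ... | tri≈ _ e _ | _ | _ = index-≢ s₁ s₂ a12 e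
    ... | _ | tri≈ _ e _ | _ = index-≢ s₂ s₃ a23 e
    ... | _ | _ | tri≈ _ e _ = index-≢ s₁ s₃ a13 e
    ... | tri< a _ _ | tri< b _ _ | _          = no-three-ordered s₁ s₂ s₃ a1S a2M a3S a12 a23 a b
    ... | tri< a _ _ | tri> _ _ b | tri< c _ _ = no-three-ordered s₁ s₃ s₂ a1S a3M a2S a13 (λ v p q → a23 v q p) c b
    ... | tri< a _ _ | tri> _ _ b | tri> _ _ c = no-three-ordered s₃ s₁ s₂ a3S a1M a2S (λ v p q → a13 v q p) a12 c a
    ... | tri> _ _ a | tri< b _ _ | tri< c _ _ = no-three-ordered s₂ s₁ s₃ a2S a1M a3S (λ v p q → a12 v q p) a13 a c
    ... | tri> _ _ a | tri< b _ _ | tri> _ _ c = no-three-ordered s₂ s₃ s₁ a2S a3M a1S a23 (λ v p q → a13 v q p) b c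
    ... | tri> _ _ a | tri> _ _ b | _          = no-three-ordered s₃ s₂ s₁ a3S a2M a1S (λ v p q → a23 v q p) (λ v p q → a12 v q p) b a

-- Decidable reachability and finite comprehension.

module _ {m : ℕ} {R : Fin m → Fin m → Set} (R? : ∀ u v → Dec (R u v)) where

  private
    -- A walk whose inner vertices belong to the list, as in the Floyd-Warshall algorithm.
    Via : List (Fin m) → Fin m → Fin m → Set
    Via []       u v = u ≡ v ⊎ R u v
    Via (w ∷ ws) u v = Via ws u v ⊎ (Via ws u w × Via ws w v)

    via? : ∀ ws u v → Dec (Via ws u v)
    via? []       u v = u ≟ v ⊎-dec R? u v
    via? (w ∷ ws) u v = via? ws u v ⊎-dec (via? ws u w ×-dec via? ws w v)

    via-base : ∀ ws {u v} → u ≡ v ⊎ R u v → Via ws u v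
    via-base []       b = b
    via-base (w ∷ ws) b = inj₁ (via-base ws b)

    -- Whatever lies between two visits of a pivot is dropped, so each pivot is split at only once.
    via-trans : ∀ {ws u w v} → w ∈ₗ ws → Via ws u w → Via ws w v → Via ws u v
    via-trans {_ ∷ ws} (here refl) p q = inj₂ (to p , from q)
      where
      to : ∀ {u w} → Via (w ∷ ws) u w → Via ws u w
      to (inj₁ p)       = p
      to (inj₂ (p , _)) = p
      from : ∀ {w v} → Via (w ∷ ws) w v → Via ws w v
      from (inj₁ q)       = q
      from (inj₂ (_ , q)) = q
    via-trans (there i) (inj₁ p)       (inj₁ q)       = inj₁ (via-trans i p q)
    via-trans (there i) (inj₁ p)       (inj₂ (q , r)) = inj₂ (via-trans i p q , r)
    via-trans (there i) (inj₂ (p , q)) (inj₁ r)       = inj₂ (p , via-trans i q r)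
    via-trans (there i) (inj₂ (p , _)) (inj₂ (_ , r)) = inj₂ (p , r)

    via⇒star : ∀ ws {u v} → Via ws u v → Star R u v
    via⇒star []       (inj₁ refl)    = ε
    via⇒star []       (inj₂ r)       = r ◅ ε
    via⇒star (w ∷ ws) (inj₁ p)       = via⇒star ws p
    via⇒star (w ∷ ws) (inj₂ (p , q)) = via⇒star ws p ◅◅ via⇒star ws q

    star⇒via : ∀ {u v} → Star R u v → Via (allFin m) u v
    star⇒via ε       = via-base (allFin m) (inj₁ refl)
    star⇒via (r ◅ w) = via-trans (∈-allFin _) (via-base (allFin m) (inj₂ r)) (star⇒via w)

  star? : ∀ u v → Dec (Star R u v)
  star? u v = map′ (via⇒star (allFin m)) star⇒via (via? (allFin m) u v)

module _ {m : ℕ} {P : Fin m → Set} (P? : Decidable P) where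

  comprehension : Subset m
  comprehension = tabulate (does ∘ P?)

  ∈-comprehension⁺ : ∀ {v} → P v → v ∈ comprehension
  ∈-comprehension⁺ {v} p = lookup⇒[]= v comprehension (trans (lookup∘tabulate (does ∘ P?) v) (dec-true (P? v) p))

  ∈-comprehension⁻ : ∀ {v} → v ∈ comprehension → P v
  ∈-comprehension⁻ {v} v∈ with P? v | trans (sym (lookup∘tabulate (does ∘ P?) v)) ([]=⇒lookup v∈)
  ... | yes p | _ = p

⌊n*2/2⌋ : ∀ j → ⌊ j * 2 /2⌋ ≡ j
⌊n*2/2⌋ zero    = refl
⌊n*2/2⌋ (suc j) = cong suc (⌊n*2/2⌋ j)

⌊1+n*2/2⌋ : ∀ j → ⌊ suc (j * 2) /2⌋ ≡ j
⌊1+n*2/2⌋ zero    = refl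
⌊1+n*2/2⌋ (suc j) = cong suc (⌊1+n*2/2⌋ j)

⌊n/2⌋⁻¹ : ∀ m {j} → ⌊ m /2⌋ ≡ j → m ≡ j * 2 ⊎ m ≡ suc (j * 2)
⌊n/2⌋⁻¹ zero          refl = inj₁ refl
⌊n/2⌋⁻¹ (suc zero)    refl = inj₂ refl
⌊n/2⌋⁻¹ (suc (suc m)) refl with ⌊n/2⌋⁻¹ m refl
... | inj₁ e = inj₁ (cong (2 +_) e)
... | inj₂ e = inj₂ (cong (2 +_) e)

-- Walks in the plane graph and paths in the intersection graph.

module _ (G : PlaneGraph) where
  open PlaneGraph G

  adj? : ∀ u v → Dec (Adj G u v)
  adj? u v = any? λ x → (tail x ≟ u) ×-dec (tail (α x) ≟ v)

  comp-Adj : ∀ {u v} → Adj G u v → comp u ≡ comp v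
  comp-Adj (x , refl , refl) = sym (comp-edge x)

  comp-Within : ∀ {P : Fin n → Set} {u v} → Star (Within G P) u v → comp u ≡ comp v
  comp-Within = Star.fold (λ u v → comp u ≡ comp v) (λ (_ , _ , a) e → trans (comp-Adj a) e) refl

  first-exit : ∀ {P D : Fin n → Set} → Decidable D → ∀ {u v} → Star (Within G P) u v → D u → ¬ D v →
    ∃[ a ] ∃[ b ] (Star (Within G (P ∩ D)) u a × D a × P a × P b × ¬ D b × Adj G a b)
  first-exit D? ε du ¬dv = ⊥-elim (¬dv du)
  first-exit D? {u} (_◅_ {j = w} (pu , pw , a) walk) du ¬dv with D? w
  ... | no ¬dw = u , w , ε , du , pu , pw , ¬dw , a
  ... | yes dw with first-exit D? walk dw ¬dv
  ... | a′ , b′ , walk′ , rest = a′ , b′ , ((pu , du) , (pw , dw) , a) ◅ walk′ , rest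

  outerIndex : ∀ {v o} → OnOuterFace G v → outerDart (comp v) ≡ just o → ∃[ i ] tail (iter (φ G) i o) ≡ v
  outerIndex (_ , _ , inj₁ none) e with trans (sym none) e
  ... | ()
  outerIndex (_ , _ , inj₂ (o , some , y , (i , e) , t)) e′ with trans (sym some) e′
  ... | refl = i , trans (cong tail e) t

  outerDart-exists : ∀ {u v} → Adj G u v → ∃[ o ] outerDart (comp u) ≡ just o
  outerDart-exists {u} (x , e , _) with outerDart (comp u) in eq
  ... | just o  = o , refl
  ... | nothing = ⊥-elim (outerDart-nothing (comp u) x eq (cong comp e))

  module _ {ℋ : List (VSet G)} where

    path-weaken : ∀ {k l H H′} → k ≤ l → RIGPath G ℋ k H H′ → RIGPath G ℋ l H H′
    path-weaken k≤l       here         = here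
    path-weaken (s≤s k≤l) (step i m p) = step i m (path-weaken k≤l p)

    infixr 5 _⊕_
    _⊕_ : ∀ {k l H H′ H″} → RIGPath G ℋ k H H′ → RIGPath G ℋ l H′ H″ → RIGPath G ℋ (k + l) H H″
    here {k} ⊕ q   = path-weaken (m≤n+m _ k) q
    step i m p ⊕ q = step i m (p ⊕ q)

    -- A `RIGPath` certifies membership in `ℋ` only after its start, so reversal needs it for the
    -- start as well.
    path-sym : ∀ {k H H′} → H ∈ₗ ℋ → RIGPath G ℋ k H H′ → RIGPath G ℋ k H′ H
    path-sym H∈ here = here
    path-sym {suc k} H∈ (step i (v , p , q) r) =
      path-weaken (≤-reflexive (+-comm k 1)) (path-sym i r ⊕ step {k = 0} H∈ (v , q , p) here)

  -- Levels and pieces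

  module Layers (ℋ : List (VSet G))
    (ℋ-connected : ∀ H → H ∈ₗ ℋ → Connected G H) (ℋ-outer : ∀ H → H ∈ₗ ℋ → HasOuter G H) (spans : Spans G ℋ)
    (R : Fin c → VSet G) (R-connected : ∀ k → Connected G (R k)) (R-outer : ∀ k → HasOuter G (R k))
    (R-comp : ∀ k v → v ∈ R k → comp v ≡ k) (R-diam : ∀ k → WDiam≤ G ℋ 2 (R k)) where

    Ball : ℕ → Fin n → Set
    Ball zero    v = v ∈ R (comp v)
    Ball (suc j) v = Ball j v ⊎ ∃[ H ] (H ∈ₗ ℋ × v ∈ H × ∃[ u ] (u ∈ H × Ball j u))

    ball? : ∀ j → Decidable (Ball j)
    ball? zero    v = v ∈? R (comp v)
    ball? (suc j) v = ball? j v ⊎-dec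
      map′ find (λ (_ , i , p) → lose i p) (Any.any? (λ H → (v ∈? H) ×-dec any? (λ u → (u ∈? H) ×-dec ball? j u)) ℋ)

    ball-mono : ∀ {i j v} → i ≤ j → Ball i v → Ball j v
    ball-mono {j = zero}  z≤n       b        = b
    ball-mono {j = suc j} z≤n       b        = inj₁ (ball-mono {j = j} z≤n b)
    ball-mono             (s≤s i≤j) (inj₁ b) = inj₁ (ball-mono i≤j b)
    ball-mono             (s≤s i≤j) (inj₂ (H , i , p , u , q , b)) = inj₂ (H , i , p , u , q , ball-mono i≤j b)

    ball-step : ∀ {j H u v} → H ∈ₗ ℋ → u ∈ H → v ∈ H → Ball j u → Ball (suc j) v
    ball-step i p q b = inj₂ (_ , i , q , _ , p , b)

    in-ball : ∀ v → ∃[ j ] Ball j v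
    in-ball v with R-connected (comp v)
    ... | (r , r∈) , _ = along (comp-conn r v (R-comp _ r r∈)) (0 , subst (λ k → r ∈ R k) (sym (R-comp _ r r∈)) r∈)
      where
      along : ∀ {u v} → Star (Adj G) u v → ∃[ j ] Ball j u → ∃[ j ] Ball j v
      along ε       b       = b
      along (a ◅ w) (j , b) with spans _ _ a
      ... | H , i , p , q = along w (suc j , ball-step i p q b)

    abstract
      level : Fin n → ℕ
      level v = proj₁ (least (λ j → ball? j v) (proj₂ (in-ball v)))

      level-ball : ∀ v → Ball (level v) v
      level-ball v = proj₁ (proj₂ (least (λ j → ball? j v) (proj₂ (in-ball v))))

      level-least : ∀ {j v} → Ball j v → level v ≤ j
      level-least {j} {v} b = ≮⇒≥ λ j<l → proj₂ (proj₂ (proj₂ (least (λ j → ball? j v) (proj₂ (in-ball v))))) j j<l b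

    R-level : ∀ {k w} → w ∈ R k → level w ≤ 0
    R-level {w = w} w∈ = level-least {0} (subst (λ k → w ∈ R k) (sym (R-comp _ w w∈)) w∈)

    level-Lipschitz : ∀ {H u v} → H ∈ₗ ℋ → u ∈ H → v ∈ H → level v ≤ suc (level u)
    level-Lipschitz {u = u} i p q = level-least (ball-step i p q (level-ball u))

    -- A member of `ℋ` that meets ball `j` lies in ball `suc j` and is connected, so each step
    -- inwards can be walked inside the ball.
    walk-to-R : ∀ j {v} → Ball j v → ∃[ r ] (r ∈ R (comp v) × Star (Within G (λ w → level w ≤ j)) v r)
    walk-to-R zero    {v} b = v , b , ε
    walk-to-R (suc j) (inj₁ b) with walk-to-R j b
    ... | r , r∈ , w = r , r∈ , Within-map G m≤n⇒m≤1+n w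
    walk-to-R (suc j) {v} (inj₂ (H , i , p , u , q , b)) with walk-to-R j b
    ... | r , r∈ , w = r , subst (λ k → r ∈ R k) (sym (comp-Within v⟶u)) r∈ ,
                       Within-map G (λ p′ → level-least (ball-step i q p′ b)) v⟶u ◅◅ Within-map G m≤n⇒m≤1+n w
      where
      v⟶u = proj₂ (ℋ-connected H i) v u p q

    path-to-R : ∀ j {v H} → Ball j v → H ∈ₗ ℋ → v ∈ H → ∃[ H₀ ] (H₀ ∈ₗ ℋ × RIGPath G ℋ j H H₀ × Meets G H₀ (R (comp v)))
    path-to-R zero    {v} {H} b i p = H , i , here , v , p , b
    path-to-R (suc j) (inj₁ b) i p with path-to-R j b i p
    ... | H₀ , i₀ , path , m = H₀ , i₀ , path-weaken (n≤1+n j) path , m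
    path-to-R (suc j) {v} (inj₂ (H′ , i′ , p′ , u , q , b)) i p with path-to-R j b i′ q
    ... | H₀ , i₀ , path , m = H₀ , i₀ , step i′ (_ , p , p′) path ,
                               subst (λ k → Meets G H₀ (R k)) (sym (comp-Within (proj₂ (ℋ-connected H′ i′) v u p′ q))) m

    -- A member of ℋ through a vertex of level j + 1 that meets level j.
    record Parent (j : ℕ) (v : Fin n) : Set where
      field
        set     : VSet G
        set∈    : set ∈ₗ ℋ
        v∈      : v ∈ set
        low     : Fin n
        low∈    : low ∈ set
        low≡    : level low ≡ j
        between : ∀ {w} → w ∈ set → level w ≡ j ⊎ level w ≡ suc j

    -- Minimality of the level selects the second alternative of `Ball`. Levels in a member differ
    -- by at most one, so a member with vertices of levels `j` and `suc j` has no others.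
    parent-set : ∀ {j v} → level v ≡ suc j → Parent j v
    parent-set {j} {v} e with subst (λ l → Ball l v) e (level-ball v)
    ... | inj₁ b = ⊥-elim (<⇒≱ (n<1+n j) (subst (_≤ j) e (level-least b)))
    ... | inj₂ (H , i , p , u , q , b) = record
      { set = H ; set∈ = i ; v∈ = p ; low = u ; low∈ = q ; low≡ = u≡
      ; between = λ {w} w∈ → exact (≤-pred (subst (_≤ suc (level w)) e (level-Lipschitz i w∈ p)))
                                   (subst (λ l → level w ≤ suc l) u≡ (level-Lipschitz i q w∈)) }
      where
      u≡ : level u ≡ j
      u≡ = ≤-antisym (level-least b) (≤-pred (subst (_≤ suc (level u)) e (level-Lipschitz i q p)))
      exact : ∀ {l} → j ≤ l → l ≤ suc j → l ≡ j ⊎ l ≡ suc j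
      exact j≤l l≤1+j with m≤n⇒m<n∨m≡n l≤1+j
      ... | inj₁ l<1+j = inj₁ (≤-antisym (≤-pred l<1+j) j≤l)
      ... | inj₂ l≡1+j = inj₂ l≡1+j

    open Parent

    parent-walk : ∀ {j v} (p : Parent j v) {a b} → a ∈ set p → b ∈ set p → Star (Within G (_∈ set p)) a b
    parent-walk p = proj₂ (ℋ-connected (set p) (set∈ p)) _ _

    -- The truncated predecessor puts level 0 together with levels 1 and 2; annulus `suc j` consists
    -- of the levels 2j+3 and 2j+4.
    annulus : Fin n → ℕ
    annulus v = ⌊ pred (level v) /2⌋

    annulus-odd : ∀ {v} j → level v ≡ suc (j * 2) → annulus v ≡ j
    annulus-odd j e = trans (cong (λ l → ⌊ pred l /2⌋) e) (⌊n*2/2⌋ j)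

    annulus-even : ∀ {v} j → level v ≡ suc (suc (j * 2)) → annulus v ≡ j
    annulus-even j e = trans (cong (λ l → ⌊ pred l /2⌋) e) (⌊1+n*2/2⌋ j)

    annulus-suc : ∀ {v} j → annulus v ≡ suc j → level v ≡ suc (suc j * 2) ⊎ level v ≡ suc (suc (suc j * 2))
    annulus-suc {v} j e with level v
    ... | suc l with ⌊n/2⌋⁻¹ l e
    ... | inj₁ refl = inj₁ refl
    ... | inj₂ refl = inj₂ refl

    annulus-zero : ∀ {v} → annulus v ≡ 0 → level v ≤ 2
    annulus-zero {v} e with level v
    ... | 0 = z≤n
    ... | 1 = s≤s z≤n
    ... | 2 = s≤s (s≤s z≤n)

    annulus-zero⁻ : ∀ {v} → level v ≤ 2 → annulus v ≡ 0
    annulus-zero⁻ {v} le with level v | le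
    ... | 0 | _ = refl
    ... | 1 | _ = refl
    ... | 2 | _ = refl
    ... | suc (suc (suc _)) | s≤s (s≤s ())

    Same : Fin n → Fin n → Set
    Same u v = Adj G u v × annulus u ≡ annulus v

    same? : ∀ u v → Dec (Same u v)
    same? u v = adj? u v ×-dec (annulus u ℕ.≟ annulus v)

    _≈_ : Fin n → Fin n → Set
    _≈_ = Star Same

    ≈-sym : ∀ {u v} → u ≈ v → v ≈ u
    ≈-sym = Star.reverse λ (a , e) → Adj-sym G a , sym e

    ≈-annulus : ∀ {u v} → u ≈ v → annulus u ≡ annulus v
    ≈-annulus = Star.fold (λ u v → annulus u ≡ annulus v) (λ (_ , e) e′ → trans e e′) refl

    ≈-comp : ∀ {u v} → u ≈ v → comp u ≡ comp v
    ≈-comp = Star.fold (λ u v → comp u ≡ comp v) (λ (a , _) e → trans (comp-Adj a) e) refl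

    Within⇒≈ : ∀ {P : Fin n → Set} {j} → (∀ {v} → P v → annulus v ≡ j) → ∀ {u v} → Star (Within G P) u v → u ≈ v
    Within⇒≈ P⇒j = Star.map λ (p , q , a) → a , trans (P⇒j p) (sym (P⇒j q))

    ≈⇒Within : ∀ {v a b} → v ≈ a → a ≈ b → Star (Within G (v ≈_)) a b
    ≈⇒Within p ε       = ε
    ≈⇒Within p (s ◅ w) = (p , p′ , proj₁ s) ◅ ≈⇒Within p′ w
      where p′ = p ◅◅ (s ◅ ε)

    piece : Fin n → VSet G
    piece v = comprehension (star? same? v)

    ∈-piece⁺ : ∀ {v w} → v ≈ w → w ∈ piece v
    ∈-piece⁺ = ∈-comprehension⁺ (star? same? _)

    ∈-piece⁻ : ∀ {v w} → w ∈ piece v → v ≈ w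
    ∈-piece⁻ = ∈-comprehension⁻ (star? same? _)

    piece-connected : ∀ v → Connected G (piece v)
    piece-connected v = (v , ∈-piece⁺ ε) , λ a b p q →
      Within-map G ∈-piece⁺ (≈⇒Within (∈-piece⁻ p) (≈-sym (∈-piece⁻ p) ◅◅ ∈-piece⁻ q))

    pieces-disjoint : ∀ u v → piece u ≡ piece v ⊎ Disjoint G (piece u) (piece v)
    pieces-disjoint u v with star? same? u v
    ... | yes p = inj₁ (⊆-antisym (λ q → ∈-piece⁺ (≈-sym p ◅◅ ∈-piece⁻ q)) (λ q → ∈-piece⁺ (p ◅◅ ∈-piece⁻ q)))
    ... | no ¬p = inj₂ λ (_ , q , r) → ¬p (∈-piece⁻ q ◅◅ ≈-sym (∈-piece⁻ r))

    -- The parent member of a vertex on the upper level of an annulus stays inside that annulus,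
    -- hence in the piece, and brings its outer vertex along.
    even-level-outer : ∀ {v} j → level v ≡ suc (suc (j * 2)) → HasOuter G (piece v)
    even-level-outer {v} j e with parent-set e
    ... | p with ℋ-outer (set p) (set∈ p)
    ... | u , u∈ , out = u , ∈-piece⁺ (Within⇒≈ same-annulus (parent-walk p (v∈ p) u∈)) , out
      where
      same-annulus : ∀ {w} → w ∈ set p → annulus w ≡ j
      same-annulus w∈ with between p w∈
      ... | inj₁ e = annulus-odd j e
      ... | inj₂ e = annulus-even j e

    -- An edge from the component of v in its level 2j + 3 down to level 2j + 2.
    record Descent (j : ℕ) (v : Fin n) : Set where
      field
        up       : Parent (suc (suc (j * 2))) v
        leave    : Fin n
        v≈leave  : v ≈ leave
        arrive   : Fin n
        arrive∈  : arrive ∈ set up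
        arrive≡  : level arrive ≡ suc (suc (j * 2))
        adjacent : Adj G leave arrive

    -- Along the parent member only levels 2j+2 and 2j+3 occur, so the first exit from the upper of
    -- these lands on the lower.
    descent : ∀ {v} j → level v ≡ suc (suc j * 2) → Descent j v
    descent {v} j e with parent-set e
    ... | p with first-exit (λ w → level w ℕ.≟ suc (suc j * 2)) (parent-walk p (v∈ p) (low∈ p)) e
                            (λ e′ → <⇒≢ (n<1+n _) (trans (sym (low≡ p)) e′))
    ... | a , b , walk , _ , _ , b∈ , b≢ , adj = record
      { up = p ; leave = a ; v≈leave = Within⇒≈ (λ (_ , e) → annulus-odd (suc j) e) walk
      ; arrive = b ; arrive∈ = b∈ ; arrive≡ = lower (between p b∈) ; adjacent = adj }
      where
      lower : level b ≡ suc (suc (j * 2)) ⊎ level b ≡ suc (suc j * 2) → level b ≡ suc (suc (j * 2))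
      lower (inj₁ e) = e
      lower (inj₂ e) = ⊥-elim (b≢ e)

    open Descent

    odd-level-step : ∀ {v} j (p : Parent (suc (suc j * 2)) v) → v ≈ low p
    odd-level-step j p = Within⇒≈ same-annulus (parent-walk p (v∈ p) (low∈ p))
      where
      same-annulus : ∀ {w} → w ∈ set p → annulus w ≡ suc j
      same-annulus w∈ with between p w∈
      ... | inj₁ e = annulus-odd (suc j) e
      ... | inj₂ e = annulus-even (suc j) e

    descend : ∀ {v} j → annulus v ≡ suc j → ∃[ w ] (v ≈ w × Descent j w)
    descend {v} j e with annulus-suc j e
    ... | inj₁ e′ = v , ε , descent j e′
    ... | inj₂ e′ with parent-set e′
    ... | p = low p , odd-level-step j p , descent j (low≡ p)

    -- The descent arrives on the upper level of the preceding annulus, where every piece has an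
    -- outer vertex.
    touches-outer : ∀ {v} j → annulus v ≡ suc j → ∃[ b ] (Touches G (piece v) (piece b) × HasOuter G (piece b))
    touches-outer {v} j e with descend j e
    ... | w , v≈w , D = arrive D ,
      ( (λ (x , p , q) → 1+n≢n (trans (sym e) (trans (≈-annulus (∈-piece⁻ p)) (trans (sym (≈-annulus (∈-piece⁻ q))) (annulus-even j (arrive≡ D))))))
      , leave D , arrive D , ∈-piece⁺ (v≈w ◅◅ v≈leave D) , ∈-piece⁺ ε , adjacent D) ,
      even-level-outer j (arrive≡ D)

    annulus-zero-outer : ∀ {v} → annulus v ≡ 0 → HasOuter G (piece v)
    annulus-zero-outer {v} e with walk-to-R 2 (ball-mono (annulus-zero e) (level-ball v)) | R-outer (comp v)
    ... | r , r∈ , w | u , u∈ , out =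
      u , ∈-piece⁺ (Within⇒≈ annulus-zero⁻ w ◅◅ Within⇒≈ in-R (proj₂ (R-connected (comp v)) r u r∈ u∈)) , out
      where
      in-R : ∀ {w} → w ∈ R (comp v) → annulus w ≡ 0
      in-R w∈ = annulus-zero⁻ (≤-trans (R-level w∈) z≤n)

    annulus-zero-near : ∀ {v w H} → annulus v ≡ 0 → v ≈ w → H ∈ₗ ℋ → w ∈ H →
                        ∃[ H₀ ] (H₀ ∈ₗ ℋ × RIGPath G ℋ 2 H H₀ × Meets G H₀ (R (comp v)))
    annulus-zero-near {v} {w} e v≈w i p
      with path-to-R 2 (ball-mono (annulus-zero (trans (sym (≈-annulus v≈w)) e)) (level-ball w)) i p
    ... | H₀ , i₀ , path , m = H₀ , i₀ , path , subst (λ k → Meets G H₀ (R k)) (sym (≈-comp v≈w)) m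

    annulus-zero-diam : ∀ {v} → annulus v ≡ 0 → WDiam≤ G ℋ 10 (piece v)
    annulus-zero-diam {v} e H H′ i i′ (w , p , q) (w′ , p′ , q′) =
      let (H₀ , i₀ , path , m)      = annulus-zero-near e (∈-piece⁻ q) i p
          (H₀′ , i₀′ , path′ , m′) = annulus-zero-near e (∈-piece⁻ q′) i′ p′
      -- Two steps from each end to a member meeting the root set, and two between those members.
      in path-weaken (m≤m+n 6 4) (path ⊕ R-diam (comp v) H₀ H₀′ i₀ i₀′ m m′ ⊕ path-sym i′ path′)

    -- Anchors, spines and the diameter of the outer pieces.

    record Anchor (k j : ℕ) (v : Fin n) : Set where
      field
        {base}    : Fin n
        -- `outward` occupies levels 2j+1 and 2j+2 and leads to the outer face; `inward` occupies 2j
        -- and 2j+1 and leads to the ball.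
        outward   : Parent (suc (j * 2)) base
        inward    : Parent (j * 2) (low outward)
        contact   : Fin n
        v≈contact : v ≈ contact
        joined    : Adj G base contact
        near      : ∀ {H} → H ∈ₗ ℋ → v ∈ H → RIGPath G ℋ k H (set outward)

    open Anchor

    anchor-odd : ∀ {v} j → level v ≡ suc (suc j * 2) → Anchor 2 j v
    anchor-odd {v} j e = record
      { outward = p ; inward = parent-set (low≡ p) ; contact = leave D ; v≈contact = v≈leave D ; joined = Adj-sym G (adjacent D)
      -- The first step shares `v`, the second the arrival vertex of the descent.
      ; near = λ i v∈H → step (set∈ (up D)) (v , v∈H , v∈ (up D)) (step (set∈ p) (arrive D , arrive∈ D , v∈ p) here) }
      where
      D = descent j e
      p = parent-set (arrive≡ D)

    -- A vertex on the upper level of its annulus spends one more step, to the low vertex of its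
    -- parent member.
    anchor : ∀ {v} j → annulus v ≡ suc j → Anchor 3 j v
    anchor {v} j e with annulus-suc j e
    ... | inj₁ odd = record
      { outward = outward A ; inward = inward A ; contact = contact A ; v≈contact = v≈contact A ; joined = joined A
      ; near = λ i v∈H → path-weaken (n≤1+n 2) (near A i v∈H) }
      where A = anchor-odd j odd
    ... | inj₂ even = record
      { outward = outward A ; inward = inward A ; contact = contact A ; v≈contact = odd-level-step j p ◅◅ v≈contact A ; joined = joined A
      ; near = λ i v∈H → step (set∈ p) (v , v∈H , v∈ p) (near A (set∈ p) (low∈ p)) }
      where
      p = parent-set even
      A = anchor-odd j (low≡ p)

    -- Cutting the inner set off at level 2j keeps the spine away from the ball; only the part up to
    -- the first exit is walked along, so the spine itself need not be connected.
    Spine : ∀ {k j v} → Anchor k j v → Fin n → Set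
    Spine {j = j} A w = w ∈ set (outward A) ⊎ (w ∈ set (inward A) × j * 2 < level w)

    spine? : ∀ {k j v} (A : Anchor k j v) → Decidable (Spine A)
    spine? {j = j} A w = (w ∈? set (outward A)) ⊎-dec ((w ∈? set (inward A)) ×-dec (j * 2 <? level w))

    spine-above : ∀ {k j v w} (A : Anchor k j v) → Spine A w → j * 2 < level w
    spine-above A (inj₂ (_ , lt)) = lt
    spine-above A (inj₁ w∈) with between (outward A) w∈
    ... | inj₁ e = ≤-reflexive (sym e)
    ... | inj₂ e = ≤-trans (n≤1+n _) (≤-reflexive (sym e))

    spine-below : ∀ {k j v w} (A : Anchor k j v) → Spine A w → level w ≤ suc (suc (j * 2))
    spine-below A (inj₁ w∈) with between (outward A) w∈
    ... | inj₁ e = ≤-trans (≤-reflexive e) (n≤1+n _)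
    ... | inj₂ e = ≤-reflexive e
    spine-below A (inj₂ (w∈ , _)) with between (inward A) w∈
    ... | inj₁ e = ≤-trans (≤-reflexive e) (≤-trans (n≤1+n _) (n≤1+n _))
    ... | inj₂ e = ≤-trans (≤-reflexive e) (n≤1+n _)

    annulus-above : ∀ {w} j → annulus w ≡ suc j → suc (suc (j * 2)) < level w
    annulus-above j e with annulus-suc j e
    ... | inj₁ e′ = ≤-reflexive (sym e′)
    ... | inj₂ e′ = ≤-trans (n≤1+n _) (≤-reflexive (sym e′))

    Overlap : ∀ {j v v′} → Anchor 3 j v → Anchor 3 j v′ → Set
    Overlap A A′ = ∃[ w ] (Spine A w × Spine A′ w)

    overlap? : ∀ {j v v′} (A : Anchor 3 j v) (A′ : Anchor 3 j v′) → Dec (Overlap A A′)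
    overlap? A A′ = any? λ w → spine? A w ×-dec spine? A′ w

    spine-near : ∀ {k j v w} (A : Anchor k j v) → Spine A w → ∃[ H ] (H ∈ₗ ℋ × w ∈ H × RIGPath G ℋ 1 H (set (outward A)))
    spine-near A (inj₁ w∈)       = set (outward A) , set∈ (outward A) , w∈ , here
    spine-near A (inj₂ (w∈ , _)) = set (inward A) , set∈ (inward A) , w∈ ,
      step (set∈ (outward A)) (low (outward A) , v∈ (inward A) , low∈ (outward A)) here

    -- At most one step from each `outward` set to a member through the common vertex, and one
    -- between these two members.
    overlap-path : ∀ {j v v′} (A : Anchor 3 j v) (A′ : Anchor 3 j v′) → Overlap A A′ → RIGPath G ℋ 3 (set (outward A)) (set (outward A′))
    overlap-path A A′ (w , s , s′) =
      let (H , i , p , path)     = spine-near A s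
          (H′ , i′ , p′ , path′) = spine-near A′ s′
      in path-sym i path ⊕ step i′ (w , p , p′) path′

    -- Spines as spokes on the outer face.

    module _ {o v₀ j} (outer : outerDart (comp v₀) ≡ just o) (v₀∈j : annulus v₀ ≡ suc j) where

      private
        center : Fin n
        center = proj₁ (R-outer (comp v₀))

        center∈ : center ∈ R (comp v₀)
        center∈ = proj₁ (proj₂ (R-outer (comp v₀)))

        centerIndex : ∃[ i ] tail (iter (φ G) i o) ≡ center
        centerIndex = outerIndex (proj₂ (proj₂ (R-outer (comp v₀)))) (trans (cong outerDart (R-comp _ center center∈)) outer)

        x : Fin d
        x = iter (φ G) (proj₁ centerIndex) o

        x≡center : tail x ≡ center
        x≡center = proj₂ centerIndex

        S : Fin n → Set
        S w = level w ≤ j * 2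

        R⊆S : ∀ {w} → w ∈ R (comp v₀) → S w
        R⊆S w∈ = ≤-trans (R-level w∈) z≤n

        -- From `x` the orbit returns to `o` and from there reaches `u`; the least exponent for that
        -- dart is its first visit.
        visit : ∀ {u} → comp u ≡ comp v₀ → OnOuterFace G u →
                ∃[ m ] (tail (iter (φ G) m x) ≡ u × (∀ m′ → m′ < m → iter (φ G) m′ x ≢ iter (φ G) m x))
        visit u∈ out with outerIndex out (trans (cong outerDart u∈) outer) | iter-return (φ G) (φ-injective G) (proj₁ centerIndex) o
        ... | i , e | i′ , back
          with least (λ m → iter (φ G) m x ≟ iter (φ G) i o) {i + i′} (trans (iter-+ (φ G) i i′ x) (cong (iter (φ G) i) back))
        ... | m , e′ , _ , min = m , trans (cong tail e′) e , λ m′ lt eq → min m′ lt (trans eq e′)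

        -- The spoke ends at an outer vertex of the `outward` set, which leads to the contact with
        -- the piece. Through its low vertex it also leads along the `inward` set until level 2j is
        -- reached, then inside the ball to the root set.
        spoke : ∀ {v} → v₀ ≈ v → (A : Anchor 3 j v) → Spoke G x S (v₀ ≈_) (Spine A)
        spoke {v} v₀≈v A with ℋ-outer (set (outward A)) (set∈ (outward A))
        ... | u , u∈ , out with visit comp-u out
          where
          comp-u : comp u ≡ comp v₀
          comp-u = trans (comp-Within (parent-walk (outward A) u∈ (v∈ (outward A))))
                         (trans (comp-Adj (joined A)) (sym (≈-comp (v₀≈v ◅◅ v≈contact A))))
        ... | m , refl , first with
          first-exit (λ w → j * 2 <? level w) (parent-walk (inward A) (v∈ (inward A)) (low∈ (inward A)))
                     (≤-reflexive (sym (low≡ (outward A)))) (λ lt → <⇒≢ lt (sym (low≡ (inward A))))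
        ... | a , b , walk , a-above , a∈ , _ , b-below , adj
          with walk-to-R (j * 2) (ball-mono (≮⇒≥ b-below) (level-ball b))
        ... | r , r∈ , walk′ = record
          { index = m ; first = first ; end∈P = inj₁ u∈
          ; to-S = Within-map G (inj₁ ∘ inj₁) to-low ◅◅ Within-map G (inj₁ ∘ inj₂) walk
                   ◅◅ ((inj₁ (inj₂ (a∈ , a-above)) , inj₂ (≮⇒≥ b-below) , adj) ◅ Within-map G inj₂ walk′)
                   ◅◅ subst (Star _ r) (sym x≡center) (Within-map G (inj₂ ∘ R⊆S) (proj₂ (R-connected (comp v₀)) r center r∈R center∈))
          ; entry = contact A ; entry∈M = v₀≈v ◅◅ v≈contact A
          ; to-M = Within-map G (inj₁ ∘ inj₁) (parent-walk (outward A) u∈ (v∈ (outward A)))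
                   ◅◅ ((inj₁ (inj₁ (v∈ (outward A))) , inj₂ (v₀≈v ◅◅ v≈contact A) , joined A) ◅ ε) }
          where
          to-low = parent-walk (outward A) u∈ (low∈ (outward A))
          r∈R : r ∈ R (comp v₀)
          r∈R = subst (λ k → r ∈ R k) (trans (sym (comp-Adj adj)) (trans (sym (comp-Within walk)) (trans (sym (comp-Within to-low))
                  (trans (comp-Within (parent-walk (outward A) u∈ (v∈ (outward A))))
                  (trans (comp-Adj (joined A)) (sym (≈-comp (v₀≈v ◅◅ v≈contact A)))))))) r∈

      -- Ball, spines and piece occupy disjoint ranges of levels: up to 2j, then 2j+1 and 2j+2, then
      -- from 2j+3 on. Three disjoint spines would thus give three forbidden spokes.
      overlapping-pair : ∀ {u v w} → v₀ ≈ u → v₀ ≈ v → v₀ ≈ w →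
        (A : Anchor 3 j u) (B : Anchor 3 j v) (C : Anchor 3 j w) → ¬ Overlap A B → ¬ Overlap A C → ¬ Overlap B C → ⊥
      overlapping-pair pu pv pw A B C ab ac bc =
        no-three-spokes G outer (trans (cong comp x≡center) (R-comp _ center center∈))
          (subst S (sym x≡center) (R⊆S center∈))
          (λ w s m → <⇒≱ (annulus-above j (trans (sym (≈-annulus m)) v₀∈j)) (≤-trans s (≤-trans (n≤1+n _) (n≤1+n _))))
          (λ p q → ≈⇒Within p (≈-sym p ◅◅ q))
          (spoke pu A) (spoke pv B) (spoke pw C)
          (off-S A) (off-S B) (off-S C) (off-M A) (off-M B) (off-M C)
          (λ w p q → ab (w , p , q)) (λ w p q → ac (w , p , q)) (λ w p q → bc (w , p , q))
        where
        off-S : ∀ {v} (A : Anchor 3 j v) → Apart G (Spine A) S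
        off-S A w p s = <⇒≱ (spine-above A p) s
        off-M : ∀ {v} (A : Anchor 3 j v) → Apart G (Spine A) (v₀ ≈_)
        off-M A w p m = <⇒≱ (annulus-above j (trans (sym (≈-annulus m)) v₀∈j)) (spine-below A p)

    -- Follow a walk of the piece from w to w′ as long as the spines meet that of w; the first one
    -- that does not meets the spine of w′.
    annulus-suc-diam : ∀ {v} j → annulus v ≡ suc j → WDiam≤ G ℋ 30 (piece v)
    annulus-suc-diam {v} j e H H′ i i′ (w , w∈H , q) (w′ , w′∈H′ , q′) =
      follow v≈w (≈-sym v≈w ◅◅ v≈w′) A (base A , inj₁ (v∈ (outward A)) , inj₁ (v∈ (outward A)))
      where
      v≈w  = ∈-piece⁻ q
      v≈w′ = ∈-piece⁻ q′

      anchorOf : ∀ {u} → v ≈ u → Anchor 3 j u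
      anchorOf v≈u = anchor j (trans (sym (≈-annulus v≈u)) e)

      A  = anchorOf v≈w
      A′ = anchorOf v≈w′

      follow : ∀ {u} → v ≈ u → u ≈ w′ → (B : Anchor 3 j u) → Overlap A B → RIGPath G ℋ 30 H H′
      follow v≈u ε B AB = path-weaken (m≤m+n 9 21)
        (near A i w∈H ⊕ overlap-path A B AB ⊕ path-sym i′ (near B i′ w′∈H′))
      follow v≈u (s@(adj , _) ◅ walk) B AB with anchorOf (v≈u ◅◅ (s ◅ ε))
      ... | C with overlap? A C | overlap? A′ C
      ... | yes AC | _       = follow (v≈u ◅◅ (s ◅ ε)) walk C AC
      -- The member `K` containing the current edge is near both `B` and `C`. The path has six
      -- sections of length at most 3.
      ... | no _   | yes A′C = let (K , k , u∈K , u′∈K) = spans _ _ adj in path-weaken (m≤m+n 18 12)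
        (near A i w∈H ⊕ overlap-path A B AB ⊕ path-sym k (near B k u∈K) ⊕ near C k u′∈K
         ⊕ path-sym (set∈ (outward A′)) (overlap-path A′ C A′C) ⊕ path-sym i′ (near A′ i′ w′∈H′))
      ... | no ¬AC | no ¬A′C with overlap? A A′
      ... | yes AA′ = path-weaken (m≤m+n 9 21) (near A i w∈H ⊕ overlap-path A A′ AA′ ⊕ path-sym i′ (near A′ i′ w′∈H′))
      -- The spines of `A`, `A′` and `C` would be pairwise disjoint. The edge `adj` guarantees that
      -- the component has an outer dart.
      ... | no ¬AA′ = ⊥-elim (overlapping-pair outer e v≈w v≈w′ (v≈u ◅◅ (s ◅ ε)) A A′ C ¬AA′ ¬AC ¬A′C)
        where
        dart  = outerDart-exists adj
        outer = subst (λ k → outerDart k ≡ just (proj₁ dart)) (sym (≈-comp v≈u)) (proj₂ dart)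

    pieces : List (VSet G)
    pieces = map piece (allFin n)

    piece∈ : ∀ v → piece v ∈ₗ pieces
    piece∈ v = ∈-map⁺ piece (∈-allFin v)

    ∈-pieces⁻ : ∀ {M} → M ∈ₗ pieces → ∃[ v ] M ≡ piece v
    ∈-pieces⁻ i = let (v , _ , e) = ∈-map⁻ piece i in v , e

    piece-diam : ∀ v → WDiam≤ G ℋ 30 (piece v)
    piece-diam v with annulus v in e
    ... | zero  = λ H H′ i i′ m m′ → path-weaken (m≤m+n 10 20) (annulus-zero-diam e H H′ i i′ m m′)
    ... | suc j = annulus-suc-diam j e

    piece-good : ∀ v → GoodMember G ℋ pieces (piece v)
    piece-good v with annulus v in e
    ... | zero  = inj₁ (annulus-zero-outer e , annulus-zero-diam e)
    ... | suc j = let (b , touch , out) = touches-outer j e in inj₂ (piece b , piece∈ b , touch , out)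

-- Root sets of the components.

module _ (G : PlaneGraph) (ℋ : List (VSet G)) where
  open PlaneGraph G

  record RootSet (k : Fin c) : Set where
    field
      carrier   : VSet G
      connected : Connected G carrier
      outer     : HasOuter G carrier
      inside    : ∀ v → v ∈ carrier → comp v ≡ k
      diam      : WDiam≤ G ℋ 2 carrier

  -- Two members that meet `H` are joined by the path through `H`, whence the bound 2.
  member-root : ∀ {H v} → Connected G H → HasOuter G H → H ∈ₗ ℋ → v ∈ H → RootSet (comp v)
  member-root {H} {v} conn out i v∈H = record
    { carrier = H ; connected = conn ; outer = out
    ; inside = λ u u∈H → comp-Within G (proj₂ conn u v u∈H v∈H)
    ; diam = λ { H₁ H₂ i₁ i₂ m (w , p , q) → step i m (step i₂ (w , q , p) here) } }

  module _ (ℬ : List (VSet G)) (ℬ-connected : ∀ B → B ∈ₗ ℬ → Connected G B)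
    (ℬ-good : ∀ B → B ∈ₗ ℬ → GoodMember G ℋ ℬ B)
    (cases : ∀ K → IsComponentOutside G ℬ K → ComponentCase G ℋ ℬ K) where

    -- A connected set containing `v` is just `v` and touches nothing. So whether `v` lies in a
    -- member of `ℬ` or is a component outside `ℬ`, every alternative left puts it on the outer
    -- face. The diameter bound is vacuous, as no member of `ℋ` contains `v`.
    isolated-root : ∀ v → (∀ w → ¬ Adj G v w) → ¬ InUnion G ℋ v → RootSet (comp v)
    isolated-root v isolated v∉ = record
      { carrier = ⁅ v ⁆ ; connected = singleton-connected ; outer = v , x∈⁅x⁆ v , v-outer
      ; inside = λ u u∈ → cong comp (x∈⁅y⁆⇒x≡y v u∈)
      ; diam = λ { H _ i _ (w , w∈H , w∈) _ → ⊥-elim (v∉ (H , i , subst (_∈ H) (x∈⁅y⁆⇒x≡y v w∈) w∈H)) } }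
      where
      no-edge : ∀ {u w} → u ∈ ⁅ v ⁆ → ¬ Adj G u w
      no-edge u∈ rewrite x∈⁅y⁆⇒x≡y v u∈ = isolated _

      stuck : ∀ {P : Fin n → Set} {u} → Star (Within G P) v u → u ≡ v
      stuck ε                 = refl
      stuck ((_ , _ , a) ◅ _) = ⊥-elim (isolated _ a)

      singleton-connected : Connected G ⁅ v ⁆
      singleton-connected = (v , x∈⁅x⁆ v) , λ u w p q →
        subst (Star _ u) (trans (x∈⁅y⁆⇒x≡y v p) (sym (x∈⁅y⁆⇒x≡y v q))) ε

      outer-in : ∀ {A} → v ∈ A → Connected G A → HasOuter G A → OnOuterFace G v
      outer-in v∈A conn (u , u∈A , out) = subst (OnOuterFace G) (stuck (proj₂ conn v u v∈A u∈A)) out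

      untouching : ∀ {A B} → v ∈ A → Connected G A → ¬ Touches G A B
      untouching v∈A conn (_ , u , w , u∈A , _ , a) = isolated w (subst (λ u → Adj G u w) (stuck (proj₂ conn v u v∈A u∈A)) a)

      v-outer : OnOuterFace G v
      v-outer with Any.any? (v ∈?_) ℬ
      ... | yes some with find some
      ...   | B , i , v∈B with ℬ-good B i
      ...     | inj₁ (out , _)             = outer-in v∈B (ℬ-connected B i) out
      ...     | inj₂ (_ , _ , touches , _) = ⊥-elim (untouching v∈B (ℬ-connected B i) touches)
      v-outer | no none with cases ⁅ v ⁆
          ( (λ { u u∈ (B , i , u∈B) → none (lose i (subst (_∈ B) (x∈⁅y⁆⇒x≡y v u∈) u∈B)) })
          , singleton-connected , λ u w u∈ _ a → ⊥-elim (no-edge u∈ a))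
      ... | inj₁ (inj₁ (_ , out))                 = outer-in (x∈⁅x⁆ v) singleton-connected out
      ... | inj₁ (inj₂ (_ , _ , _ , touches , _)) = ⊥-elim (untouching (x∈⁅x⁆ v) singleton-connected touches)
      ... | inj₂ (inj₁ (out , _))                 = outer-in (x∈⁅x⁆ v) singleton-connected out
      ... | inj₂ (inj₂ (inj₁ (out , _)))          = outer-in (x∈⁅x⁆ v) singleton-connected out
      ... | inj₂ (inj₂ (inj₂ (out , _)))          = outer-in (x∈⁅x⁆ v) singleton-connected out

theorem3p3 : (G : PlaneGraph) (ℋ ℬ : List (VSet G)) →
    (∀ H → H ∈ₗ ℋ → Connected G H) →
    (∀ H → H ∈ₗ ℋ → HasOuter G H) →
    Spans G ℋ →
    (∀ B → B ∈ₗ ℬ → Connected G B) →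
    PairwiseDisjoint G ℬ →
    (∀ B → B ∈ₗ ℬ → WDiam≤ G ℋ 30 B) →
    (∀ B → B ∈ₗ ℬ → GoodMember G ℋ ℬ B) →
    (∀ K → IsComponentOutside G ℬ K → ComponentCase G ℋ ℬ K) →
    ∃[ ℳ ] ((∀ M → M ∈ₗ ℳ → Connected G M) ×
    PairwiseDisjoint G ℳ ×
    (∀ v → InUnion G ℳ v) ×
    (∀ M → M ∈ₗ ℳ → WDiam≤ G ℋ 30 M) ×
    (∀ M → M ∈ₗ ℳ → GoodMember G ℋ ℳ M))
theorem3p3 G ℋ ℬ ℋ-connected ℋ-outer spans ℬ-connected _ _ ℬ-good cases =
  L.pieces , (λ M → onPiece (Connected G) L.piece-connected) , disjoint , (λ v → L.piece v , L.piece∈ v , L.∈-piece⁺ ε) ,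
  (λ M → onPiece (WDiam≤ G ℋ 30) L.piece-diam) , (λ M → onPiece (GoodMember G ℋ L.pieces) L.piece-good)
  where
  open PlaneGraph G

  root : ∀ k → RootSet G ℋ k
  root k with comp-onto k
  ... | v , refl with Any.any? (v ∈?_) ℋ
  ... | yes some = let (H , i , v∈H) = find some in member-root G ℋ (ℋ-connected H i) (ℋ-outer H i) i v∈H
  -- Since `ℋ` spans, a vertex in no member has no incident edge.
  ... | no none  = isolated-root G ℋ ℬ ℬ-connected ℬ-good cases v
                     (λ w a → let (_ , i , v∈H , _) = spans v w a in none (lose i v∈H))
                     (λ (_ , i , v∈H) → none (lose i v∈H))

  open RootSet

  module L = Layers G ℋ ℋ-connected ℋ-outer spans
    (λ k → carrier (root k)) (λ k → connected (root k)) (λ k → outer (root k)) (λ k → inside (root k)) (λ k → diam (root k))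

  onPiece : ∀ (P : VSet G → Set) → (∀ v → P (L.piece v)) → ∀ {M} → M ∈ₗ L.pieces → P M
  onPiece P p i with L.∈-pieces⁻ i
  ... | v , refl = p v

  disjoint : PairwiseDisjoint G L.pieces
  disjoint A B i i′ with L.∈-pieces⁻ i | L.∈-pieces⁻ i′
  ... | u , refl | v , refl = L.pieces-disjoint u v
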